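{- Fix a real number $q$ with $0<q<\frac12$. For each integer $n\ge 1$, consider the two-phase game with parameters $(q,n)$ described in the context, and let $E_n(q)$ be the conditional expectation of the duration of Phase II given that team B wins. Then $E_n(q)\to\frac{1-q}{(1-2q)^2}$ as $n\to\infty$. More precisely, as $n\to\infty$, $$E_n(q)=\frac{1-q}{(1-2q)^2}\Bigg(1-\frac{1}{(1-2q)^2}\cdot\frac1n-\frac{6q^2-6q-1}{(1-2q)^4}\cdot\frac1{n^2}-\frac{36q^4-72q^3+12q^2+24q+1}{(1-2q)^6}\cdot\frac1{n^3}$$ $$\qquad-\frac{216q^6-648q^5+276q^4+528q^3-306q^2-66q-1}{(1-2q)^8}\cdot\frac1{n^4}\Bigg)+O\!\left(\frac1{n^5}\right).$$
   Context: The two-phase game with parameters $q\in(0,\frac12)$ and positive integer $n$: two teams, G and B, play; each successive goal is scored by B with probability $q$ and by G with probability $1-q$, independently of all other goals. Phase I: play until G has scored $n$ goals; let $m$ be the number of goals B has scored by then. Phase II: if $m\ge n$, team B is declared the winner immediately (Phase II has duration $0$). If $m<n$, they keep playing until B has caught up and tied the score, in which case B is declared the winner; if B never ties the score, B loses. The duration of Phase II is the number of goals scored (by either team) during Phase II. The implied constant in $O(\cdot)$ may depend on the fixed $q$. -}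

module Defs where

open import Level using (_⊔_) renaming (suc to lsuc)
open import Algebra.Apartness.Bundles using (HeytingCommutativeRing; HeytingField)
open import Algebra.Bundles using (CommutativeRing)
open import Data.Bool.Base using (if_then_else_)
open import Data.List.Base using (List; []; _∷_; foldl)
open import Data.Nat.Base as ℕ using (ℕ; zero; suc; NonZero; _≡ᵇ_; _≤ᵇ_)
open import Data.Product.Base using (Σ-syntax; ∃-syntax; _×_; _,_; proj₁; proj₂)
open import Data.Sum.Base using (_⊎_)
open import Relation.Binary.Core using (Rel)
open import Relation.Binary.Structures using (IsStrictPartialOrder)
open import Relation.Nullary.Negation using (¬_)
import Algebra.Properties.CommutativeSemiring.Exp as Exp
import Algebra.Properties.Group as GroupProperties
import Algebra.Properties.Semiring.Mult as Mult
import Relation.Binary.Reasoning.Setoid as ≈-Reasoning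

-- The strict order and the apartness are the primitive relations, so that the
-- ordered-field part also makes sense constructively, where the order of the
-- reals is not decidable.
record OrderedField c ℓ₁ ℓ₂ : Set (lsuc (c ⊔ ℓ₁ ⊔ ℓ₂)) where
  infix 4 _<_
  field
    heytingField : HeytingField c ℓ₁ ℓ₂
  open HeytingField heytingField public
  field
    _<_                    : Rel Carrier ℓ₂
    <-isStrictPartialOrder : IsStrictPartialOrder _≈_ _<_
    <⇒#                    : ∀ {x y} → x < y → x # y
    #⇒<                    : ∀ {x y} → x # y → x < y ⊎ y < x
    0<1                    : 0# < 1#
    +-monoˡ-<              : ∀ z {x y} → x < y → x + z < y + z
    *-pos                  : ∀ {x y} → 0# < x → 0# < y → 0# < x * y

  module <-order = IsStrictPartialOrder <-isStrictPartialOrder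

  open HeytingCommutativeRing heytingCommutativeRing public using (commutativeRing)
  open CommutativeRing commutativeRing public
    using (+-group; semiring; commutativeSemiring)

  open Mult semiring public using () renaming (_×_ to infixr 8 _·_)
  open Exp commutativeSemiring public using (_^_)

  infix 4 _≤_
  _≤_ : Rel Carrier ℓ₂
  x ≤ y = ¬ (y < x)

  pos⇒#0 : ∀ {x} → 0# < x → x # 0#
  pos⇒#0 0<x = #-sym (<⇒# 0<x)

  -- `#⇒invertible` inverts `y - 0#`, which is `y`.
  infixl 7 _/_[_]
  _/_[_] : Carrier → (y : Carrier) → 0# < y → Carrier
  x / y [ 0<y ] = x * proj₁ (#⇒invertible (pos⇒#0 0<y))

  0<n·1 : ∀ n .{{_ : NonZero n}} → 0# < n · 1#
  0<n·1 (suc zero)    = <-order.<-respʳ-≈ (sym (+-identityʳ 1#)) 0<1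
  0<n·1 (suc (suc n)) = <-order.trans (0<n·1 (suc n))
    (<-order.<-respʳ-≈ refl
      (<-order.<-respˡ-≈ (+-identityˡ _) (+-monoˡ-< (suc n · 1#) 0<1)))

  Sequence : Set c
  Sequence = (n : ℕ) → .{{NonZero n}} → Carrier

  1/_ : Sequence
  1/ n = 1# / (n · 1#) [ 0<n·1 n ]

  Cauchy : Sequence → Set (c ⊔ ℓ₂)
  Cauchy x = ∀ ε → 0# < ε → ∃[ N ] ∀ m n → .{{_ : NonZero m}} .{{_ : NonZero n}} →
    N ℕ.≤ m → N ℕ.≤ n → x m < x n + ε

  infix 4 _⟶_
  _⟶_ : Sequence → Carrier → Set (c ⊔ ℓ₂)
  x ⟶ l = ∀ ε → 0# < ε → ∃[ N ] ∀ n → .{{_ : NonZero n}} →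
    N ℕ.≤ n → (x n < l + ε) × (l < x n + ε)

  -- |f n| ≤ C · g n for all large n; intended for nonnegative g.
  infix 4 _=O_
  _=O_ : Sequence → Sequence → Set (c ⊔ ℓ₂)
  f =O g = ∃[ C ] ∃[ N ] ∀ n → .{{_ : NonZero n}} →
    N ℕ.≤ n → (- (C * g n) ≤ f n) × (f n ≤ C * g n)

  q<½⇒0<1-2q : ∀ {q} → q < 1/ 2 → 0# < 1# - 2 · q
  q<½⇒0<1-2q {q} q<½ =
    <-order.<-respˡ-≈ (-‿inverseʳ (2 · q)) (+-monoˡ-< (- (2 · q)) 2q<1)
    where
    ½ = 1/ 2

    2·½≈1 : 2 · ½ ≈ 1#
    2·½≈1 = begin
      2 · ½                  ≈⟨ Mult.×-congʳ semiring 2 (*-identityˡ _) ⟩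
      2 · r                  ≈⟨ Mult.×-congʳ semiring 2 (*-identityˡ r) ⟨
      2 · (1# * r)           ≈⟨ Mult.×-assoc-* semiring 2 1# r ⟨
      (2 · 1#) * r           ≈⟨ *-congʳ 2·1-0≈2·1 ⟨
      (2 · 1# - 0#) * r      ≈⟨ proj₂ (proj₂ inv) ⟩
      1#                     ∎
      where
      open ≈-Reasoning setoid
      inv = #⇒invertible (pos⇒#0 (0<n·1 2))
      r = proj₁ inv
      2·1-0≈2·1 : 2 · 1# - 0# ≈ 2 · 1#
      2·1-0≈2·1 = trans (+-congˡ (GroupProperties.ε⁻¹≈ε +-group)) (+-identityʳ _)

    q+½<½+½ : q + (½ + 0#) < ½ + (½ + 0#)
    q+½<½+½ = +-monoˡ-< _ q<½

    q+q<q+½ : q + (q + 0#) < q + (½ + 0#)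
    q+q<q+½ = <-order.<-respʳ-≈ (+-comm _ _)
      (<-order.<-respˡ-≈ (+-comm _ _) (+-monoˡ-< q (+-monoˡ-< 0# q<½)))

    2q<1 : 2 · q < 1#
    2q<1 = <-order.<-respʳ-≈ 2·½≈1 (<-order.trans q+q<q+½ q+½<½+½)

-- The real numbers, axiomatised as a Cauchy complete archimedean ordered field.
record RealNumbers c ℓ₁ ℓ₂ : Set (lsuc (c ⊔ ℓ₁ ⊔ ℓ₂)) where
  field
    orderedField : OrderedField c ℓ₁ ℓ₂
  open OrderedField orderedField public
  field
    archimedean : ∀ x → ∃[ n ] x < n · 1#
    complete    : ∀ x → Cauchy x → ∃[ l ] x ⟶ l

data Team : Set where
  G B : Team

-- In `phaseI g b` and `phaseII g b t` the score is g : b; t is the number of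
-- goals scored so far in Phase II.  `bWins t` records that B has been declared
-- the winner after a Phase II of duration t, and is absorbing.
data State : Set where
  phaseI  : (g b : ℕ) → State
  phaseII : (g b t : ℕ) → State
  bWins   : (t : ℕ) → State

endPhaseI : (n b : ℕ) → State
endPhaseI n b = if n ≤ᵇ b then bWins 0 else phaseII n b 0

step : ℕ → State → Team → State
step n (phaseI g b)    G = if suc g ≡ᵇ n then endPhaseI n b else phaseI (suc g) b
step n (phaseI g b)    B = phaseI g (suc b)
step n (phaseII g b t) G = phaseII (suc g) b (suc t)
step n (phaseII g b t) B = if suc b ≡ᵇ g then bWins (suc t) else phaseII g (suc b) (suc t)
step n (bWins t)       _ = bWins t

play : ℕ → List Team → State
play n = foldl (step n) (phaseI 0 0)

module TwoPhaseGame {c ℓ₁ ℓ₂} (ℝ : RealNumbers c ℓ₁ ℓ₂) where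
  open RealNumbers ℝ

  -- Expectation of a function of the first L goals, each of which is scored by B
  -- with probability q and by G with probability 1 - q, independently.
  𝔼 : (q : Carrier) (L : ℕ) → (List Team → Carrier) → Carrier
  𝔼 q zero    X = X []
  𝔼 q (suc L) X =
    (1# - q) * 𝔼 q L (λ goals → X (G ∷ goals)) + q * 𝔼 q L (λ goals → X (B ∷ goals))

  𝟙[bWins] : State → Carrier
  𝟙[bWins] (bWins _) = 1#
  𝟙[bWins] _         = 0#

  duration*𝟙[bWins] : State → Carrier
  duration*𝟙[bWins] (bWins t) = t · 1#
  duration*𝟙[bWins] _         = 0#

  -- e = E[duration of Phase II ; B wins] / P(B wins).  If B wins then this is
  -- settled after finitely many goals, so P(B wins) is the limit, as L → ∞, of
  -- the probability that B has won within L goals; likewise, by monotone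
  -- convergence, for the expectation of the duration on the event that B wins.
  IsConditionalExpectation : (q : Carrier) (n : ℕ) → Carrier → Set (c ⊔ ℓ₁ ⊔ ℓ₂)
  IsConditionalExpectation q n e =
    ∃[ d ] ∃[ p ] Σ[ 0<p ∈ 0# < p ]
      ((λ L → 𝔼 q L (λ goals → duration*𝟙[bWins] (play n goals))) ⟶ d) ×
      ((λ L → 𝔼 q L (λ goals → 𝟙[bWins] (play n goals))) ⟶ p) ×
      e ≈ d / p [ 0<p ]

module Submission where

-- Let D = 1 - 2q, and let πₙ be the probability that each team scores n of the
-- first 2n goals.  Conditioned on B eventually tying the score, the game is one
-- with the scoring probabilities q and 1 - q exchanged.  So B is as likely to win
-- in Phase II as at the end of Phase I, and for the probability pₙ that B wins and
-- the expected duration dₙ on that event one finds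
--
--   pₙ - pₙ₊₁ = D πₙ,   2 q D dₙ = n (πₙ - D pₙ),   (n + 1) πₙ₊₁ = 2 (2n + 1) q (1 - q) πₙ.
--
-- Hence pₙ / πₙ satisfies a first order linear recurrence.  A polynomial in 1/n
-- which satisfies it up to O(n⁻⁶) approximates pₙ / πₙ up to O(n⁻⁶), since the
-- errors Σ_{k ≥ n} O(k⁻⁶) πₖ telescope to O(n⁻⁶) pₙ; inverting it expands dₙ / pₙ.
--
-- That the expectations over the first L goals converge to pₙ and dₙ follows from
-- a function on the states (`potential`) which dominates what is still to come and
-- shrinks on average by a constant factor at each goal.

open import Algebra.Bundles using (CommutativeRing)
open import Algebra.Solver.Ring.AlmostCommutativeRing
  using (fromCommutativeRing; _-Raw-AlmostCommutative⟶_)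
open import Data.Bool.Base using (true; false; T)
open import Data.Fin.Patterns using (0F; 1F; 2F)
open import Data.Integer.Base as ℤ using (ℤ; +_; -[1+_]; +0; +[1+_])
open import Data.List.Base using (foldl)
open import Data.Maybe as Maybe using (Maybe; just; nothing; is-just; to-witness-T)
open import Data.Nat.Base as ℕ using (ℕ; zero; suc; pred; NonZero; _∸_)
open import Data.Product.Base using (Σ-syntax; ∃-syntax; _×_; _,_; proj₁; proj₂)
open import Data.Sum.Base using ([_,_]′; inj₁; inj₂)
open import Data.Unit.Base using (⊤; tt)
open import Data.Vec.Base using ([]; _∷_; map; allFin)
open import Data.Vec.N-ary using (N-ary; Eq; curryⁿ; _$ⁿ_; curryⁿ-cong)
open import Data.Vec.Relation.Binary.Pointwise.Inductive as Pointwise using (Pointwise; []; _∷_)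
open import Defs
open import Level using (_⊔_)
open import Relation.Binary.PropositionalEquality.Core as ≡ using (_≡_)
open import Relation.Binary.Structures using (IsPreorder)
open import Relation.Nullary.Decidable.Core using (dec⇒maybe; proof)
open import Relation.Nullary.Negation using (¬_; contradiction)
open import Relation.Nullary.Reflects using (ofʸ; ofⁿ)
import Algebra.Apartness.Properties.HeytingCommutativeRing as HeytingProperties
import Algebra.Properties.CommutativeSemiring.Exp as Exp
import Algebra.Properties.Ring as RingProperties
import Algebra.Properties.Semiring.Mult as Mult
import Algebra.Properties.Semiring.Mult.TCOptimised as Mult′
import Algebra.Solver.Ring as RingSolver
import Data.Integer.Properties as ℤ
import Data.Nat.Properties as ℕ
import Relation.Binary.Reasoning.Base.Triple as TripleReasoning
import Relation.Binary.Reasoning.Setoid as ≈-Reasoning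

-- The quotient pₙ / πₙ is expanded, and not dₙ / pₙ itself, because its recurrence is linear. Since
-- dₙ / pₙ = n (πₙ / pₙ - D) / (2 q D), going back costs one factor n: this is why an error O(n⁻⁵)
-- requires all estimates up to O(n⁻⁶). With y = 1 / (D² n) and s = q (1 - q), every expansion is a
-- polynomial in y and s with integer coefficients, so the order of a remainder is a statement about
-- the vanishing of integer coefficients, and computation settles it. The shift from n + 1 to n is
-- the only step that is not polynomial; one more bounded variable covers it. The order is not
-- assumed decidable and `≤` is the negation of the reversed `<`. No argument may split on the sign
-- of an element; invertibility and pairs of inequalities replace such splits.

-- Ring identities with integer coefficients.

module IntegerSolver {c ℓ} (R : CommutativeRing c ℓ) where
  open CommutativeRing R
  open RingProperties ring using (-0#≈0#; -‿distribˡ-*; -‿distribʳ-*; -‿involutive; -‿+-comm)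
  open Mult′ semiring using (×-homo-+; ×1-homo-*) renaming (_×_ to _·′_)
  open ≈-Reasoning setoid

  fromℤ : ℤ → Carrier
  fromℤ (+ n)    = n ·′ 1#
  fromℤ -[1+ n ] = - (suc n ·′ 1#)

  private
    1+ : ∀ n → suc n ·′ 1# ≈ 1# + n ·′ 1#
    1+ = ×-homo-+ 1# 1

    cancel : ∀ x y z → (x + y) - (x + z) ≈ y - z
    cancel x y z = begin
      (x + y) - (x + z)      ≈⟨ +-cong (+-comm x y) (sym (-‿+-comm x z)) ⟩
      (y + x) + (- x - z)    ≈⟨ +-assoc y x _ ⟩
      y + (x + (- x - z))    ≈⟨ +-congˡ (+-assoc x (- x) (- z)) ⟨
      y + ((x - x) - z)      ≈⟨ +-congˡ (trans (+-congʳ (-‿inverseʳ x)) (+-identityˡ _)) ⟩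
      y - z                  ∎

    ⊖-homo : ∀ m n → fromℤ (m ℤ.⊖ n) ≈ m ·′ 1# - n ·′ 1#
    ⊖-homo m       zero    = sym (trans (+-congˡ -0#≈0#) (+-identityʳ _))
    ⊖-homo zero    (suc n) = sym (+-identityˡ _)
    ⊖-homo (suc m) (suc n) = begin
      fromℤ (suc m ℤ.⊖ suc n)            ≡⟨ ≡.cong fromℤ (ℤ.[1+m]⊖[1+n]≡m⊖n m n) ⟩
      fromℤ (m ℤ.⊖ n)                    ≈⟨ ⊖-homo m n ⟩
      m ·′ 1# - n ·′ 1#                  ≈⟨ cancel 1# _ _ ⟨
      (1# + m ·′ 1#) - (1# + n ·′ 1#)    ≈⟨ +-cong (1+ m) (-‿cong (1+ n)) ⟨
      suc m ·′ 1# - suc n ·′ 1#          ∎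

    neg-homo : ∀ i → fromℤ (ℤ.- i) ≈ - fromℤ i
    neg-homo +0         = sym -0#≈0#
    neg-homo +[1+ n ]   = refl
    neg-homo -[1+ n ]   = sym (-‿involutive _)

    +-homo : ∀ i j → fromℤ (i ℤ.+ j) ≈ fromℤ i + fromℤ j
    +-homo (+ m)    (+ n)    = ×-homo-+ 1# m n
    +-homo (+ m)    -[1+ n ] = ⊖-homo m (suc n)
    +-homo -[1+ m ] (+ n)    = trans (⊖-homo n (suc m)) (+-comm _ _)
    +-homo -[1+ m ] -[1+ n ] = begin
      - (suc (suc (m ℕ.+ n)) ·′ 1#)         ≈⟨ -‿cong (1+ (suc (m ℕ.+ n))) ⟩
      - (1# + (suc m ℕ.+ n) ·′ 1#)          ≈⟨ -‿cong (+-congˡ (×-homo-+ 1# (suc m) n)) ⟩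
      - (1# + (suc m ·′ 1# + n ·′ 1#))      ≈⟨ -‿cong (trans (sym (+-assoc 1# _ _)) (trans (+-congʳ (+-comm 1# _)) (+-assoc _ 1# _))) ⟩
      - (suc m ·′ 1# + (1# + n ·′ 1#))      ≈⟨ -‿cong (+-congˡ (1+ n)) ⟨
      - (suc m ·′ 1# + suc n ·′ 1#)         ≈⟨ -‿+-comm _ _ ⟨
      - (suc m ·′ 1#) - suc n ·′ 1#         ∎

    ++-homo : ∀ m n → fromℤ (+ m ℤ.* + n) ≈ m ·′ 1# * n ·′ 1#
    ++-homo m n = trans (reflexive (≡.cong fromℤ (≡.sym (ℤ.pos-* m n)))) (×1-homo-* m n)

    *-homo : ∀ i j → fromℤ (i ℤ.* j) ≈ fromℤ i * fromℤ j
    *-homo (+ m)    (+ n)    = ++-homo m n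
    *-homo (+ m)    -[1+ n ] = begin
      fromℤ (+ m ℤ.* -[1+ n ])          ≡⟨ ≡.cong fromℤ (ℤ.neg-distribʳ-* (+ m) (+ suc n)) ⟨
      fromℤ (ℤ.- (+ m ℤ.* + suc n))     ≈⟨ neg-homo (+ m ℤ.* + suc n) ⟩
      - fromℤ (+ m ℤ.* + suc n)         ≈⟨ -‿cong (++-homo m (suc n)) ⟩
      - (m ·′ 1# * suc n ·′ 1#)         ≈⟨ -‿distribʳ-* _ _ ⟩
      m ·′ 1# * - (suc n ·′ 1#)         ∎
    *-homo -[1+ m ] (+ n)    = begin
      fromℤ (-[1+ m ] ℤ.* + n)          ≡⟨ ≡.cong fromℤ (ℤ.neg-distribˡ-* (+ suc m) (+ n)) ⟨
      fromℤ (ℤ.- (+ suc m ℤ.* + n))     ≈⟨ neg-homo (+ suc m ℤ.* + n) ⟩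
      - fromℤ (+ suc m ℤ.* + n)         ≈⟨ -‿cong (++-homo (suc m) n) ⟩
      - (suc m ·′ 1# * n ·′ 1#)         ≈⟨ -‿distribˡ-* _ _ ⟩
      - (suc m ·′ 1#) * n ·′ 1#         ∎
    *-homo -[1+ m ] -[1+ n ] = begin
      (suc m ℕ.* suc n) ·′ 1#                   ≈⟨ ×1-homo-* (suc m) (suc n) ⟩
      suc m ·′ 1# * suc n ·′ 1#                 ≈⟨ -‿involutive _ ⟨
      - - (suc m ·′ 1# * suc n ·′ 1#)           ≈⟨ -‿cong (-‿distribʳ-* _ _) ⟩
      - (suc m ·′ 1# * - (suc n ·′ 1#))         ≈⟨ -‿distribˡ-* _ _ ⟩
      - (suc m ·′ 1#) * - (suc n ·′ 1#)         ∎

    ℤ-morphism : ℤ.+-*-rawRing -Raw-AlmostCommutative⟶ fromCommutativeRing R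
    ℤ-morphism = record
      { ⟦_⟧    = fromℤ
      ; +-homo = +-homo
      ; *-homo = *-homo
      ; -‿homo = neg-homo
      ; 0-homo = refl
      ; 1-homo = refl
      }

  open RingSolver ℤ.+-*-rawRing (fromCommutativeRing R) ℤ-morphism
    (λ i j → Maybe.map (λ i≡j → reflexive (≡.cong fromℤ i≡j)) (dec⇒maybe (i ℤ.≟ j)))
    public hiding (solve)

  int : ∀ {n} → ℕ → Polynomial n
  int k = con (+ k)

  private
    close : ∀ {A : Set} n → N-ary n (Polynomial n) A → A
    close n f = f $ⁿ map var (allFin n)

  -- Unlike the library's `solve`, this decides the equality of the two normal
  -- forms by computation in ℤ, without ever unfolding them in R.
  solve : ∀ n (f : N-ary n (Polynomial n) (Polynomial n × Polynomial n)) →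
    {T (is-just (normalise (proj₁ (close n f)) ≟N normalise (proj₂ (close n f))))} →
    Eq n _≈_ (curryⁿ ⟦ proj₁ (close n f) ⟧) (curryⁿ ⟦ proj₂ (close n f) ⟧)
  solve n f {eq} = curryⁿ-cong _≈_ ⟦ e₁ ⟧ ⟦ e₂ ⟧
    (λ ρ → prove ρ e₁ e₂ (⟦ to-witness-T (normalise e₁ ≟N normalise e₂) eq ⟧N-cong ρ))
    where
    e₁ e₂ : Polynomial n
    e₁ = proj₁ (close n f)
    e₂ = proj₂ (close n f)

-- Inequalities in an ordered field without a decidable order.

module OrderedFieldProperties {c ℓ₁ ℓ₂} (F : OrderedField c ℓ₁ ℓ₂) where
  open OrderedField F
  open HeytingProperties heytingCommutativeRing using (invertibleˡ⇒#; #-congʳ)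
  open IntegerSolver commutativeRing

  -- Here l ≈ r is to be a sum of multiples of the hypotheses, so that the second
  -- premise is a ring identity.
  linear-combination : ∀ {x y l r} → l ≈ r → x + r ≈ y + l → x ≈ y
  linear-combination {x} {y} {l} {r} l≈r x+r≈y+l = begin
    x            ≈⟨ solve 2 (λ x r → x := (x :+ r) :- r) x r ⟩
    (x + r) - r  ≈⟨ +-cong x+r≈y+l (-‿cong (sym l≈r)) ⟩
    (y + l) - l  ≈⟨ solve 2 (λ y l → (y :+ l) :- l := y) y l ⟩
    y            ∎
    where open ≈-Reasoning setoid

  <-respʳ : ∀ {x y z} → y ≈ z → x < y → x < z
  <-respʳ = <-order.<-respʳ-≈

  <-respˡ : ∀ {x y z} → y ≈ z → y < x → z < x
  <-respˡ = <-order.<-respˡ-≈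

  <-irrefl : ∀ {x} → ¬ (x < x)
  <-irrefl = <-order.irrefl refl

  <-asym : ∀ {x y} → x < y → ¬ (y < x)
  <-asym x<y y<x = <-irrefl (<-order.trans x<y y<x)

  <⇒≤ : ∀ {x y} → x < y → x ≤ y
  <⇒≤ = <-asym

  -- Cotransitivity sets `z` apart from `x` or from `y`. In either case one of the two possible
  -- orders is the conclusion or yields it, and the other gives `z < y`, which `y ≤ z` refutes.
  <-≤-trans : ∀ {x y z} → x < y → y ≤ z → x < z
  <-≤-trans {x} {y} {z} x<y y≤z = [ case₁ , case₂ ]′ (#-cotrans (<⇒# x<y) z)
    where
    case₁ : x # z → x < z
    case₁ x#z with #⇒< x#z
    ... | inj₁ x<z = x<z
    ... | inj₂ z<x = contradiction (<-order.trans z<x x<y) y≤z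
    case₂ : z # y → x < z
    case₂ z#y with #⇒< z#y
    ... | inj₁ z<y = contradiction z<y y≤z
    ... | inj₂ y<z = <-order.trans x<y y<z

  ≤-<-trans : ∀ {x y z} → x ≤ y → y < z → x < z
  ≤-<-trans {x} {y} {z} x≤y y<z = [ case₁ , case₂ ]′ (#-cotrans (<⇒# y<z) x)
    where
    case₁ : y # x → x < z
    case₁ y#x with #⇒< y#x
    ... | inj₁ y<x = contradiction y<x x≤y
    ... | inj₂ x<y = <-order.trans x<y y<z
    case₂ : x # z → x < z
    case₂ x#z with #⇒< x#z
    ... | inj₁ x<z = x<z
    ... | inj₂ z<x = contradiction (<-order.trans y<z z<x) x≤y

  ≤-isPreorder : IsPreorder _≈_ _≤_
  ≤-isPreorder = record
    { isEquivalence = <-order.isEquivalence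
    ; reflexive     = λ x≈y → <-order.irrefl (sym x≈y)
    ; trans         = λ x≤y y≤z z<x → x≤y (≤-<-trans y≤z z<x)
    }

  open IsPreorder ≤-isPreorder public using ()
    renaming (refl to ≤-refl; reflexive to ≤-reflexive; trans to ≤-trans; ∼-respˡ-≈ to ≤-respˡ; ∼-respʳ-≈ to ≤-respʳ)

  module ≤-Reasoning = TripleReasoning ≤-isPreorder <-asym <-order.trans
    (<-respʳ , <-respˡ) <⇒≤ <-≤-trans ≤-<-trans

  +-monoʳ-< : ∀ z {x y} → x < y → z + x < z + y
  +-monoʳ-< z x<y = <-respˡ (+-comm _ _) (<-respʳ (+-comm _ _) (+-monoˡ-< z x<y))

  +-monoˡ-≤ : ∀ z {x y} → x ≤ y → x + z ≤ y + z
  +-monoˡ-≤ z {x} {y} x≤y y+z<x+z = x≤y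
    (<-respˡ (cancel y z) (<-respʳ (cancel x z) (+-monoˡ-< (- z) y+z<x+z)))
    where
    cancel : ∀ x z → x + z - z ≈ x
    cancel = solve 2 λ x z → x :+ z :- z := x

  +-mono-≤ : ∀ {x y z w} → x ≤ y → z ≤ w → x + z ≤ y + w
  +-mono-≤ {x} {y} {z} {w} x≤y z≤w = ≤-trans (+-monoˡ-≤ z x≤y)
    (≤-respˡ (+-comm _ _) (≤-respʳ (+-comm _ _) (+-monoˡ-≤ y z≤w)))

  +-mono-<-≤ : ∀ {x y z w} → x < y → z ≤ w → x + z < y + w
  +-mono-<-≤ {x} {y} {z} {w} x<y z≤w = <-≤-trans (+-monoˡ-< z x<y) (+-mono-≤ ≤-refl z≤w)

  0≤d⇒x≤x+d : ∀ {x y d} → 0# ≤ d → y ≈ x + d → x ≤ y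
  0≤d⇒x≤x+d {x} {y} {d} 0≤d y≈x+d = ≤-respʳ (sym y≈x+d)
    (≤-respˡ (+-identityʳ x) (+-mono-≤ ≤-refl 0≤d))

  0<d⇒x<x+d : ∀ {x y d} → 0# < d → y ≈ x + d → x < y
  0<d⇒x<x+d {x} {y} {d} 0<d y≈x+d = <-respʳ (sym y≈x+d)
    (<-respˡ (+-identityʳ x) (+-monoʳ-< x 0<d))

  x≤y⇒0≤y-x : ∀ {x y} → x ≤ y → 0# ≤ y - x
  x≤y⇒0≤y-x {x} x≤y = ≤-respˡ (-‿inverseʳ x) (+-monoˡ-≤ (- x) x≤y)

  x<y⇒0<y-x : ∀ {x y} → x < y → 0# < y - x
  x<y⇒0<y-x {x} x<y = <-respˡ (-‿inverseʳ x) (+-monoˡ-< (- x) x<y)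

  neg-mono-≤ : ∀ {x y} → x ≤ y → - y ≤ - x
  neg-mono-≤ {x} {y} x≤y = 0≤d⇒x≤x+d (x≤y⇒0≤y-x x≤y)
    (solve 2 (λ x y → :- x := :- y :+ (y :- x)) x y)

  0≤+ : ∀ {x y} → 0# ≤ x → 0# ≤ y → 0# ≤ x + y
  0≤+ 0≤x 0≤y = ≤-respˡ (+-identityˡ 0#) (+-mono-≤ 0≤x 0≤y)

  0<+ : ∀ {x y} → 0# < x → 0# ≤ y → 0# < x + y
  0<+ 0<x 0≤y = <-respˡ (+-identityˡ 0#) (+-mono-<-≤ 0<x 0≤y)

  -- Being apart from 0 is the same as being invertible, and if `i` inverts `x * y` then `i * y`
  -- inverts `x`.
  x*y#0⇒x#0 : ∀ {x y} → x * y # 0# → x # 0#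
  x*y#0⇒x#0 {x} {y} xy#0 with #⇒invertible xy#0
  ... | i , i*[xy-0]≈1 , _ = invertibleˡ⇒# (i * y , trans (eq i x y) i*[xy-0]≈1)
    where
    eq : ∀ i x y → i * y * (x - 0#) ≈ i * (x * y - 0#)
    eq = solve 3 λ i x y → i :* y :* (x :- int 0) := i :* (x :* y :- int 0)

  neg-pos : ∀ {x} → x < 0# → 0# < - x
  neg-pos {x} x<0 = <-respʳ (+-identityˡ _) (x<y⇒0<y-x x<0)

  0≤x∧x#0⇒0<x : ∀ {x} → 0# ≤ x → x # 0# → 0# < x
  0≤x∧x#0⇒0<x 0≤x x#0 = [ (λ x<0 → contradiction x<0 0≤x) , (λ 0<x → 0<x) ]′ (#⇒< x#0)

  x*y#0⇒y#0 : ∀ {x y} → x * y # 0# → y # 0#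
  x*y#0⇒y#0 {x} {y} xy#0 = x*y#0⇒x#0 (#-congʳ (*-comm x y) xy#0)

  0<x*y⇒0<y : ∀ {x y} → 0# < x → 0# < x * y → 0# < y
  0<x*y⇒0<y {x} {y} 0<x 0<xy = 0≤x∧x#0⇒0<x
    (λ y<0 → contradiction
      (<-respʳ (solve 2 (λ x y → x :* y :+ x :* (:- y) := int 0) x y)
        (0<+ 0<xy (<⇒≤ (*-pos 0<x (neg-pos y<0)))))
      <-irrefl)
    (x*y#0⇒y#0 (pos⇒#0 0<xy))

  -- A negative product is invertible, so both factors are apart from 0 and hence positive, a
  -- contradiction. No distinction between zero and positive factors is made.
  *-nonneg : ∀ {x y} → 0# ≤ x → 0# ≤ y → 0# ≤ x * y
  *-nonneg {x} {y} 0≤x 0≤y xy<0 = <-asym xy<0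
    (*-pos (0≤x∧x#0⇒0<x 0≤x (x*y#0⇒x#0 (<⇒# xy<0))) (0≤x∧x#0⇒0<x 0≤y (x*y#0⇒y#0 (<⇒# xy<0))))

  *-monoˡ-≤ : ∀ {z x y} → 0# ≤ z → x ≤ y → z * x ≤ z * y
  *-monoˡ-≤ {z} {x} {y} 0≤z x≤y = 0≤d⇒x≤x+d (*-nonneg 0≤z (x≤y⇒0≤y-x x≤y))
    (solve 3 (λ x y z → z :* y := z :* x :+ z :* (y :- x)) x y z)

  *-monoʳ-≤ : ∀ {z x y} → 0# ≤ z → x ≤ y → x * z ≤ y * z
  *-monoʳ-≤ 0≤z x≤y = ≤-respˡ (*-comm _ _) (≤-respʳ (*-comm _ _) (*-monoˡ-≤ 0≤z x≤y))

  *-mono-≤ : ∀ {x y z w} → 0# ≤ x → 0# ≤ w → x ≤ y → z ≤ w → x * z ≤ y * w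
  *-mono-≤ 0≤x 0≤w x≤y z≤w = ≤-trans (*-monoˡ-≤ 0≤x z≤w) (*-monoʳ-≤ 0≤w x≤y)

  *-monoˡ-< : ∀ {z x y} → 0# < z → x < y → z * x < z * y
  *-monoˡ-< {z} {x} {y} 0<z x<y = 0<d⇒x<x+d (*-pos 0<z (x<y⇒0<y-x x<y))
    (solve 3 (λ x y z → z :* y := z :* x :+ z :* (y :- x)) x y z)

  *-cancelˡ-≤ : ∀ {z x y} → 0# < z → z * x ≤ z * y → x ≤ y
  *-cancelˡ-≤ 0<z zx≤zy y<x = zx≤zy (*-monoˡ-< 0<z y<x)

  *-cancelˡ-< : ∀ {z x y} → 0# < z → z * x < z * y → x < y
  *-cancelˡ-< {z} {x} {y} 0<z zx<zy = 0<d⇒x<x+d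
    (0<x*y⇒0<y 0<z (<-respʳ (solve 3 (λ x y z → z :* y :- z :* x := z :* (y :- x)) x y z)
      (x<y⇒0<y-x zx<zy)))
    (solve 2 (λ x y → y := x :+ (y :- x)) x y)

  y*[x/y]≈x : ∀ x {y} (0<y : 0# < y) → y * (x / y [ 0<y ]) ≈ x
  y*[x/y]≈x x {y} 0<y with #⇒invertible (pos⇒#0 0<y)
  ... | i , _ , [y-0]*i≈1 = trans
    (solve 3 (λ x y i → y :* (x :* i) := x :* ((y :- int 0) :* i)) x y i)
    (trans (*-congˡ [y-0]*i≈1) (*-identityʳ x))

  *-cancelˡ-≈ : ∀ {z x y} → 0# < z → z * x ≈ z * y → x ≈ y
  *-cancelˡ-≈ {z} {x} {y} 0<z zx≈zy =
    trans (expand x) (trans (*-congʳ zx≈zy) (sym (expand y)))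
    where
    expand : ∀ x → x ≈ z * x * (1# / z [ 0<z ])
    expand x = trans (sym (*-identityʳ x)) (trans (*-congˡ (sym (y*[x/y]≈x 1# 0<z)))
      (solve 3 (λ x z i → x :* (z :* i) := z :* x :* i) x z (1# / z [ 0<z ])))

  0<1/ : ∀ {y} (0<y : 0# < y) → 0# < 1# / y [ 0<y ]
  0<1/ 0<y = 0<x*y⇒0<y 0<y (<-respʳ (sym (y*[x/y]≈x 1# 0<y)) 0<1)

  0≤1 : 0# ≤ 1#
  0≤1 = <⇒≤ 0<1

  0≤n·1 : ∀ n → 0# ≤ n · 1#
  0≤n·1 zero    = ≤-refl
  0≤n·1 (suc n) = 0≤+ 0≤1 (0≤n·1 n)

  ·-mono-≤ : ∀ {m n} → m ℕ.≤ n → m · 1# ≤ n · 1#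
  ·-mono-≤ {n = n} ℕ.z≤n = 0≤n·1 n
  ·-mono-≤ (ℕ.s≤s m≤n)   = +-mono-≤ ≤-refl (·-mono-≤ m≤n)

  ^-nonneg : ∀ {x} n → 0# ≤ x → 0# ≤ x ^ n
  ^-nonneg zero    0≤x = 0≤1
  ^-nonneg (suc n) 0≤x = *-nonneg 0≤x (^-nonneg n 0≤x)

  ^-pos : ∀ {x} n → 0# < x → 0# < x ^ n
  ^-pos zero    0<x = 0<1
  ^-pos (suc n) 0<x = *-pos 0<x (^-pos n 0<x)

  ^-mono-≤ : ∀ {x y} n → 0# ≤ x → x ≤ y → x ^ n ≤ y ^ n
  ^-mono-≤ zero    0≤x x≤y = ≤-refl
  ^-mono-≤ (suc n) 0≤x x≤y =
    *-mono-≤ 0≤x (^-nonneg n (≤-trans 0≤x x≤y)) x≤y (^-mono-≤ n 0≤x x≤y)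

  ^≤1 : ∀ {x} n → 0# ≤ x → x ≤ 1# → x ^ n ≤ 1#
  ^≤1 zero    0≤x x≤1 = ≤-refl
  ^≤1 (suc n) 0≤x x≤1 = ≤-respʳ (*-identityˡ 1#) (*-mono-≤ 0≤x 0≤1 x≤1 (^≤1 n 0≤x x≤1))

  -- (1 - x)(1 + (k + 1) x) = 1 + k x - (k + 1) x².
  bernoulli : ∀ {x} → 0# ≤ x → 0# ≤ 1# - x → ∀ k → (1# - x) ^ k * (1# + k · 1# * x) ≤ 1#
  bernoulli {x} 0≤x 0≤1-x zero    =
    ≤-reflexive (solve 1 (λ x → int 1 :* (int 1 :+ int 0 :* x) := int 1) x)
  bernoulli {x} 0≤x 0≤1-x (suc k) = ≤-trans
    (0≤d⇒x≤x+d
      (*-nonneg (^-nonneg k 0≤1-x) (*-nonneg (0≤n·1 (suc k)) (*-nonneg 0≤x 0≤x)))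
      (solve 3 (λ x p κ → p :* (int 1 :+ κ :* x) :=
         (int 1 :- x) :* p :* (int 1 :+ (int 1 :+ κ) :* x) :+ p :* ((int 1 :+ κ) :* (x :* x)))
         x ((1# - x) ^ k) (k · 1#)))
    (bernoulli 0≤x 0≤1-x k)

  infix 4 ∣_∣≤_
  -- Two inequalities stand in for an absolute value, whose usual definition decides a sign.
  ∣_∣≤_ : Carrier → Carrier → Set ℓ₂
  ∣ x ∣≤ b = (- b ≤ x) × (x ≤ b)

  ∣∣≤-resp : ∀ {x y b} → x ≈ y → ∣ x ∣≤ b → ∣ y ∣≤ b
  ∣∣≤-resp x≈y (l , u) = ≤-respʳ x≈y l , ≤-respˡ x≈y u

  ∣∣≤-trans : ∀ {x a b} → ∣ x ∣≤ a → a ≤ b → ∣ x ∣≤ b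
  ∣∣≤-trans (l , u) a≤b = ≤-trans (neg-mono-≤ a≤b) l , ≤-trans u a≤b

  nonneg⇒∣∣≤ : ∀ {x b} → 0# ≤ x → x ≤ b → ∣ x ∣≤ b
  nonneg⇒∣∣≤ {x} {b} 0≤x x≤b =
    ≤-trans (≤-respʳ (solve 0 (:- (int 0) := int 0)) (neg-mono-≤ (≤-trans 0≤x x≤b))) 0≤x , x≤b

  ∣neg∣≤ : ∀ {x b} → ∣ x ∣≤ b → ∣ - x ∣≤ b
  ∣neg∣≤ {x} {b} (l , u) = neg-mono-≤ u ,
    ≤-respʳ (solve 1 (λ b → :- (:- b) := b) b) (neg-mono-≤ l)

  ∣+∣≤ : ∀ {x y a b} → ∣ x ∣≤ a → ∣ y ∣≤ b → ∣ x + y ∣≤ a + b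
  ∣+∣≤ {x} {y} {a} {b} (lx , ux) (ly , uy) =
    ≤-respˡ (solve 2 (λ a b → :- a :- b := :- (a :+ b)) a b) (+-mono-≤ lx ly) , +-mono-≤ ux uy

  ∣∣≤⇒0≤ : ∀ {x b} → ∣ x ∣≤ b → 0# ≤ b
  ∣∣≤⇒0≤ {x} {b} (l , u) b<0 = ≤-trans l u (<-order.trans b<0 (neg-pos b<0))

  *-∣∣≤ : ∀ {z x b} → 0# ≤ z → ∣ x ∣≤ b → ∣ z * x ∣≤ z * b
  *-∣∣≤ {z} {x} {b} 0≤z (l , u) =
    ≤-respˡ (solve 2 (λ z b → z :* (:- b) := :- (z :* b)) z b) (*-monoˡ-≤ 0≤z l) , *-monoˡ-≤ 0≤z u

  *-cancel-∣∣≤ : ∀ {z x b} → 0# < z → ∣ z * x ∣≤ z * b → ∣ x ∣≤ b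
  *-cancel-∣∣≤ {z} {x} {b} 0<z (l , u) =
    *-cancelˡ-≤ 0<z (≤-respˡ (solve 2 (λ z b → :- (z :* b) := z :* (:- b)) z b) l) ,
    *-cancelˡ-≤ 0<z u

  -- 2 (a b ± x y) = (a + x)(b ± y) + (a - x)(b ∓ y).
  ∣*∣≤ : ∀ {x y a b} → ∣ x ∣≤ a → ∣ y ∣≤ b → ∣ x * y ∣≤ a * b
  ∣*∣≤ {x} {y} {a} {b} (lx , ux) (ly , uy) =
    half (0≤+ (*-nonneg a+x b+y) (*-nonneg a-x b-y))
      (solve 4 (λ x y a b → (a :+ x) :* (b :+ y) :+ (a :- x) :* (b :- y) :=
        (x :* y :- :- (a :* b)) :+ (x :* y :- :- (a :* b))) x y a b) ,
    half (0≤+ (*-nonneg a+x b-y) (*-nonneg a-x b+y))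
      (solve 4 (λ x y a b → (a :+ x) :* (b :- y) :+ (a :- x) :* (b :+ y) :=
        (a :* b :- x :* y) :+ (a :* b :- x :* y)) x y a b)
    where
    half : ∀ {x y d} → 0# ≤ d → d ≈ (y - x) + (y - x) → x ≤ y
    half {x} {y} 0≤d d≈ y<x = 0≤d (<-respˡ (sym d≈)
      (<-respˡ (solve 2 (λ x y → :- ((x :- y) :+ (x :- y)) := (y :- x) :+ (y :- x)) x y)
        (<-respʳ (solve 0 (:- (int 0) := int 0)) (neg (0<+ 0<x-y (<⇒≤ 0<x-y))))))
      where
      0<x-y = x<y⇒0<y-x y<x
      neg : ∀ {x} → 0# < x → - x < - 0#
      neg {x} 0<x = 0<d⇒x<x+d 0<x (solve 1 (λ x → :- int 0 := :- x :+ x) x)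
    a+x : 0# ≤ a + x
    a+x = ≤-respʳ (solve 2 (λ a x → x :- :- a := a :+ x) a x) (x≤y⇒0≤y-x lx)
    a-x = x≤y⇒0≤y-x ux
    b+y : 0# ≤ b + y
    b+y = ≤-respʳ (solve 2 (λ a x → x :- :- a := a :+ x) b y) (x≤y⇒0≤y-x ly)
    b-y = x≤y⇒0≤y-x uy

-- Phase I as a lattice path problem.

record Bias {c ℓ₁ ℓ₂} (F : OrderedField c ℓ₁ ℓ₂) : Set (c ⊔ ℓ₂) where
  constructor bias
  open OrderedField F
  field
    q   : Carrier
    0<q : 0# < q
    q<½ : q < 1/ 2

module LatticePaths {c ℓ₁ ℓ₂} (F : OrderedField c ℓ₁ ℓ₂) (β : Bias F) where
  open OrderedField F hiding (zero)
  open OrderedFieldProperties F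
  open Bias β public
  open IntegerSolver commutativeRing
  open Mult semiring using (×-homo-+)

  D : Carrier
  D = 1# - 2 · q

  0<D : 0# < D
  0<D = q<½⇒0<1-2q q<½

  0<1-q : 0# < 1# - q
  0<1-q = <-respʳ (solve 1 (λ q → (int 1 :- 2 :× q) :+ q := int 1 :- q) q) (0<+ 0<D (<⇒≤ 0<q))

  a : Carrier
  a = 1# - q

  -- With i goals of G and j goals of B still to be scored: the expected reward
  -- if it is φ j once i = 0, and ψ i once j = 0.
  expected : (φ ψ : ℕ → Carrier) → ℕ → ℕ → Carrier
  expected φ ψ i       zero    = ψ i
  expected φ ψ zero    (suc j) = φ (suc j)
  expected φ ψ (suc i) (suc j) = a * expected φ ψ i (suc j) + q * expected φ ψ (suc i) j

  expected-bounds : ∀ {φ ψ b} → (∀ j → (0# ≤ φ j) × (φ j ≤ b)) → (∀ i → (0# ≤ ψ i) × (ψ i ≤ b)) →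
    ∀ i j → (0# ≤ expected φ ψ i j) × (expected φ ψ i j ≤ b)
  expected-bounds bφ bψ i       zero    = bψ i
  expected-bounds bφ bψ zero    (suc j) = bφ (suc j)
  expected-bounds {φ} {ψ} {b} bφ bψ (suc i) (suc j) =
    0≤+ (*-nonneg 0≤a (proj₁ l)) (*-nonneg 0≤q (proj₁ r)) ,
    ≤-respʳ (solve 2 (λ q b → (int 1 :- q) :* b :+ q :* b := b) q b)
      (+-mono-≤ (*-monoˡ-≤ 0≤a (proj₂ l)) (*-monoˡ-≤ 0≤q (proj₂ r)))
    where
    0≤a = <⇒≤ 0<1-q
    0≤q = <⇒≤ 0<q
    l = expected-bounds {φ} {ψ} bφ bψ i (suc j)
    r = expected-bounds {φ} {ψ} bφ bψ (suc i) j

  -- The probability that B scores j goals before G scores i.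
  first : ℕ → ℕ → Carrier
  first = expected (λ _ → 0#) (λ _ → 1#)

  -- The expected number of goals by which G then falls short of i.
  shortfall : ℕ → ℕ → Carrier
  shortfall = expected (λ _ → 0#) (λ i → i · 1#)

  -- The probability that G scores i of the first i + j goals.
  binomial : ℕ → ℕ → Carrier
  binomial zero    zero    = 1#
  binomial (suc i) zero    = a * binomial i zero
  binomial zero    (suc j) = q * binomial zero j
  binomial (suc i) (suc j) = a * binomial i (suc j) + q * binomial (suc i) j

  0≤first : ∀ i j → 0# ≤ first i j
  0≤first i j = proj₁ (expected-bounds {λ _ → 0#} {λ _ → 1#}
    (λ _ → ≤-refl , 0≤1) (λ _ → 0≤1 , ≤-refl) i j)

  0<first : ∀ i j → 0# < first (suc i) j
  0<first i zero    = 0<1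
  0<first i (suc j) = <-respʳ (+-comm _ _)
    (0<+ (*-pos 0<q (0<first i j)) (*-nonneg (<⇒≤ 0<1-q) (0≤first i (suc j))))

  0≤shortfall : ∀ i j → 0# ≤ shortfall i j
  0≤shortfall i       zero    = 0≤n·1 i
  0≤shortfall zero    (suc j) = ≤-refl
  0≤shortfall (suc i) (suc j) = 0≤+
    (*-nonneg (<⇒≤ 0<1-q) (0≤shortfall i (suc j))) (*-nonneg (<⇒≤ 0<q) (0≤shortfall (suc i) j))

  0<binomial : ∀ i j → 0# < binomial i j
  0<binomial zero    zero    = 0<1
  0<binomial (suc i) zero    = *-pos 0<1-q (0<binomial i zero)
  0<binomial zero    (suc j) = *-pos 0<q (0<binomial zero j)
  0<binomial (suc i) (suc j) =
    0<+ (*-pos 0<1-q (0<binomial i (suc j))) (<⇒≤ (*-pos 0<q (0<binomial (suc i) j)))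

  -- Both `first (suc i) j` and `first i (suc j)` are decided by the first i + j goals.
  first-exchange : ∀ i j → first (suc i) j ≈ first i (suc j) + binomial i j
  first-exchange zero    zero    = sym (+-identityˡ 1#)
  first-exchange (suc i) zero    = linear-combination (*-congˡ (first-exchange i zero))
    (solve 3 (λ q f b → int 1 :+ (int 1 :- q) :* (f :+ b) :=
       (int 1 :- q) :* f :+ q :* int 1 :+ (int 1 :- q) :* b :+ (int 1 :- q) :* int 1)
       q (first i 1) (binomial i zero))
  first-exchange zero    (suc j) = linear-combination (*-congˡ (first-exchange zero j))
    (solve 3 (λ q f b → (int 1 :- q) :* int 0 :+ q :* f :+ q :* (int 0 :+ b) :=
       int 0 :+ q :* b :+ q :* f)
       q (first 1 j) (binomial zero j))
  first-exchange (suc i) (suc j) = linear-combination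
    (+-cong (*-congˡ (first-exchange i (suc j))) (*-congˡ (first-exchange (suc i) j)))
    (solve 7 (λ a q f g h b d → a :* f :+ q :* g :+ (a :* (h :+ b) :+ q :* (f :+ d)) :=
       a :* h :+ q :* f :+ (a :* b :+ q :* d) :+ (a :* f :+ q :* g))
       a q (first (suc i) (suc j)) (first (suc (suc i)) j) (first i (suc (suc j)))
       (binomial i (suc j)) (binomial (suc i) j))

  suc·1-+ : ∀ m n → (suc m ℕ.+ n) · 1# ≈ 1# + (m · 1# + n · 1#)
  suc·1-+ m n = +-congˡ (×-homo-+ 1# m n)

  -- The absorption identities for binomial coefficients, by mutual induction: the two hypotheses at
  -- `i`, `j` together give the ratio of the two terms in Pascal's rule.
  binomial-sucˡ : ∀ i j → suc i · 1# * binomial (suc i) j ≈ (suc i ℕ.+ j) · 1# * (a * binomial i j)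
  binomial-sucʳ : ∀ i j → suc j · 1# * binomial i (suc j) ≈ (suc i ℕ.+ j) · 1# * (q * binomial i j)

  binomial-sucˡ i zero    = *-congʳ (reflexive (≡.cong (λ k → suc k · 1#) (≡.sym (ℕ.+-identityʳ i))))
  binomial-sucˡ i (suc j) = linear-combination
    (+-cong (+-cong (*-congˡ (binomial-sucˡ i j)) (*-congˡ (sym (binomial-sucʳ i j))))
            (*-congʳ (sym (suc·1-+ i (suc j)))))
    (solve 9 (λ a q b d e i j N M →
       (int 1 :+ i) :* (a :* b :+ q :* e) :+ (q :* (N :* (a :* d)) :+ a :* ((int 1 :+ j) :* b) :+ M :* (a :* b)) :=
       M :* (a :* b) :+ (q :* ((int 1 :+ i) :* e) :+ a :* (N :* (q :* d)) :+ (int 1 :+ (i :+ (int 1 :+ j))) :* (a :* b)))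
       a q (binomial i (suc j)) (binomial i j) (binomial (suc i) j)
       (i · 1#) (j · 1#) ((suc i ℕ.+ j) · 1#) ((suc i ℕ.+ suc j) · 1#))

  binomial-sucʳ zero    j = refl
  binomial-sucʳ (suc i) j = linear-combination
    (+-cong (+-cong (*-congˡ (binomial-sucʳ i j)) (*-congˡ (sym (binomial-sucˡ i j))))
            (*-congʳ (sym (suc·1-+ (suc i) j))))
    (solve 9 (λ a q b d e i j N M →
       (int 1 :+ j) :* (a :* b :+ q :* e) :+ (a :* (N :* (q :* d)) :+ q :* ((int 1 :+ i) :* e) :+ M :* (q :* e)) :=
       M :* (q :* e) :+ (a :* ((int 1 :+ j) :* b) :+ q :* (N :* (a :* d)) :+ (int 1 :+ (int 1 :+ i :+ j)) :* (q :* e)))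
       a q (binomial i (suc j)) (binomial i j) (binomial (suc i) j)
       (i · 1#) (j · 1#) ((suc i ℕ.+ j) · 1#) ((suc (suc i) ℕ.+ j) · 1#))

  -- (i + j - 1)! / ((i - 1)! (j - 1)!) aⁱ qʲ.
  corner : ℕ → ℕ → Carrier
  corner (suc i) (suc j) = (suc i ℕ.+ j) · 1# * binomial i j * (q * a)
  corner _       _       = 0#

  corner-suc : ∀ i j → corner (suc i) (suc j) ≈
    a * corner i (suc j) + q * corner (suc i) j + q * a * binomial i j
  corner-suc zero    zero    = solve 2 (λ a q →
    (int 1 :+ int 0) :* int 1 :* (q :* a) := a :* int 0 :+ q :* int 0 :+ q :* a :* int 1) a q
  corner-suc (suc i) zero    = solve 4 (λ a q b n →
    (int 1 :+ n) :* (a :* b) :* (q :* a) :=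
    a :* (n :* b :* (q :* a)) :+ q :* int 0 :+ q :* a :* (a :* b))
    a q (binomial i zero) ((suc i ℕ.+ zero) · 1#)
  corner-suc zero    (suc j) = solve 4 (λ a q b n →
    (int 1 :+ n) :* (q :* b) :* (q :* a) :=
    a :* int 0 :+ q :* (n :* b :* (q :* a)) :+ q :* a :* (q :* b))
    a q (binomial zero j) (suc j · 1#)
  corner-suc (suc i) (suc j) = linear-combination
    (*-congʳ (reflexive (≡.cong (_· 1#) (ℕ.+-suc (suc i) j))))
    (solve 6 (λ a q b e n m →
       (int 1 :+ n) :* (a :* b :+ q :* e) :* (q :* a) :+ m :* (q :* e :* (q :* a)) :=
       a :* (n :* b :* (q :* a)) :+ q :* (m :* e :* (q :* a)) :+ q :* a :* (a :* b :+ q :* e)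
         :+ n :* (q :* e :* (q :* a)))
       a q (binomial i (suc j)) (binomial (suc i) j)
       ((suc i ℕ.+ suc j) · 1#) ((suc (suc i) ℕ.+ j) · 1#))

  -- Both sides satisfy the recurrence of `expected`. Moving a target changes the factor
  -- `i q - j a`, which contributes `q a` times the difference of `first i (suc j)` and
  -- `first (suc i) j`; by `first-exchange` this is `- q a` times `binomial i j`, and `corner-suc`
  -- compensates it.
  q*shortfall : ∀ i j → q * shortfall i j ≈ (i · 1# * q - j · 1# * a) * first i j + corner i j
  q*shortfall zero    zero    =
    solve 2 (λ a q → q :* int 0 := (int 0 :* q :- int 0 :* a) :* int 1 :+ int 0) a q
  q*shortfall (suc i) zero    = solve 3 (λ a q i →
    q :* (int 1 :+ i) := ((int 1 :+ i) :* q :- int 0 :* a) :* int 1 :+ int 0) a q (i · 1#)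
  q*shortfall zero    (suc j) = solve 3 (λ a q j →
    q :* int 0 := (int 0 :* q :- (int 1 :+ j) :* a) :* int 0 :+ int 0) a q (j · 1#)
  q*shortfall (suc i) (suc j) = linear-combination
    (+-cong (+-cong (*-congˡ (q*shortfall i (suc j))) (*-congˡ (q*shortfall (suc i) j)))
            (+-cong (sym (corner-suc i j)) (*-congˡ (first-exchange i j))))
    (solve 12 (λ a q i j X Y f g c d k b →
       q :* (a :* X :+ q :* Y)
         :+ (a :* ((i :* q :- (int 1 :+ j) :* a) :* f :+ c)
             :+ q :* (((int 1 :+ i) :* q :- j :* a) :* g :+ d)
             :+ (k :+ q :* a :* (f :+ b))) :=
       ((int 1 :+ i) :* q :- (int 1 :+ j) :* a) :* (a :* f :+ q :* g) :+ k
         :+ (a :* (q :* X) :+ q :* (q :* Y)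
             :+ (a :* c :+ q :* d :+ q :* a :* b :+ q :* a :* g)))
       a q (i · 1#) (j · 1#) (shortfall i (suc j)) (shortfall (suc i) j)
       (first i (suc j)) (first (suc i) j) (corner i (suc j)) (corner (suc i) j)
       (corner (suc i) (suc j)) (binomial i j))

-- Closed forms and recurrences for equal targets.

module WinningOdds {c ℓ₁ ℓ₂} (F : OrderedField c ℓ₁ ℓ₂) (β : Bias F) where
  open OrderedField F hiding (zero)
  open OrderedFieldProperties F
  open IntegerSolver commutativeRing
  open Mult semiring using (×-homo-+)

  open LatticePaths F β public

  0<a+a : 0# < a + a
  0<a+a = 0<+ 0<1-q (<⇒≤ 0<1-q)

  δ : Carrier
  δ = 1# / D [ 0<D ]

  D*δ≈1 : D * δ ≈ 1#
  D*δ≈1 = y*[x/y]≈x 1# 0<D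

  0<δ : 0# < δ
  0<δ = 0<1/ 0<D

  -- The quadratic a z² - z + q has the roots 1 and q / (1 - q). Their midpoint is `u`, where the
  -- quadratic is negative, so `u ^ k` strictly decreases on average when B trails by k. Writing `ρ`
  -- as a multiple of `u` makes the two easy to compare.
  u : Carrier
  u = 1# / (a + a) [ 0<a+a ]

  2a*u≈1 : (a + a) * u ≈ 1#
  2a*u≈1 = y*[x/y]≈x 1# 0<a+a

  0<u : 0# < u
  0<u = 0<1/ 0<a+a

  -- B catches up a deficit of one goal with probability q / (1 - q).
  ρ : Carrier
  ρ = (q + q) * u

  0<ρ : 0# < ρ
  0<ρ = *-pos (0<+ 0<q (<⇒≤ 0<q)) 0<u

  ρ*a≈q : ρ * a ≈ q
  ρ*a≈q = linear-combination (*-congˡ 2a*u≈1)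
    (solve 3 (λ a q u → (q :+ q) :* u :* a :+ q :* int 1 := q :+ q :* ((a :+ a) :* u)) a q u)

  winReward durationReward : ℕ → ℕ → Carrier
  winReward      k t = ρ ^ k
  durationReward k t = ρ ^ k * (t · 1# + k · 1# * δ)

  valueI : (ℕ → ℕ → Carrier) → ℕ → ℕ → Carrier
  valueI w = expected (λ k → w k 0) (λ _ → w 0 0)

  win duration : ℕ → ℕ → Carrier
  win      = valueI winReward
  duration = valueI durationReward

  -- When B trails by k, it ties the score with probability ρ^k, and conditioning on
  -- this exchanges q and 1 - q.  Hence G scores i goals first and B still wins with
  -- probability ρ^(j - i) * first j i.
  win-reflection : ∀ i j → .{{NonZero (i ℕ.+ j)}} →
    ρ ^ i * win i j ≈ ρ ^ i * first i j + ρ ^ j * first j i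
  win-reflection zero    (suc j) =
    solve 1 (λ r → int 1 :* r := int 1 :* int 0 :+ r :* int 1) (ρ ^ suc j)
  win-reflection (suc i) zero    =
    solve 1 (λ r → r :* int 1 := r :* int 1 :+ int 1 :* int 0) (ρ ^ suc i)
  win-reflection (suc i) (suc j) = linear-combination
    (+-cong (+-cong (*-congˡ (win-reflection i (suc j) {{nz}})) (*-congˡ (win-reflection (suc i) j)))
            (*-congˡ ρ*a≈q))
    (solve 11 (λ a q ρ p r w₁ w₂ A₁ A₂ B₁ B₂ →
       ρ :* p :* (a :* w₁ :+ q :* w₂)
         :+ (ρ :* a :* (p :* A₁ :+ ρ :* r :* B₁) :+ q :* (ρ :* p :* A₂ :+ r :* B₂)
         :+ (ρ :* r :* B₁ :- r :* B₂) :* q) :=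
       ρ :* p :* (a :* A₁ :+ q :* A₂) :+ ρ :* r :* (a :* B₂ :+ q :* B₁)
         :+ (ρ :* a :* (p :* w₁) :+ q :* (ρ :* p :* w₂)
         :+ (ρ :* r :* B₁ :- r :* B₂) :* (ρ :* a)))
       a q ρ (ρ ^ i) (ρ ^ j) (win i (suc j)) (win (suc i) j)
       (first i (suc j)) (first (suc i) j) (first (suc j) i) (first j (suc i)))
    where
    nz : NonZero (i ℕ.+ suc j)
    nz = ≡.subst NonZero (≡.sym (ℕ.+-suc i j)) _

  -- With the probabilities exchanged, a deficit shrinks by `D` per goal on average, so a deficit k
  -- lasts k / D goals. A path with i goals of G and j - k of B has weight aⁱ qʲ⁻ᵏ; times `ρ ^ k`
  -- this is ρʲ⁻ⁱ times its weight after the exchange. There k is the number of goals by which the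
  -- other team falls short of j.
  duration-reflection : ∀ i j → D * (ρ ^ i * duration i j) ≈ ρ ^ j * shortfall j i
  duration-reflection zero    zero    = solve 2 (λ D δ →
    D :* (int 1 :* (int 1 :* (int 0 :+ int 0 :* δ))) := int 1 :* int 0) D δ
  duration-reflection (suc i) zero    = solve 3 (λ D δ r →
    D :* (r :* (int 1 :* (int 0 :+ int 0 :* δ))) := int 1 :* int 0) D δ (ρ ^ suc i)
  duration-reflection zero    (suc j) = linear-combination (*-congˡ D*δ≈1)
    (solve 4 (λ D δ r n →
      D :* (int 1 :* (r :* (int 0 :+ n :* δ))) :+ r :* n :* int 1 := r :* n :+ r :* n :* (D :* δ))
      D δ (ρ ^ suc j) (suc j · 1#))
  duration-reflection (suc i) (suc j) = linear-combination
    (+-cong (+-cong (*-congˡ (duration-reflection i (suc j))) (*-congˡ (duration-reflection (suc i) j)))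
            (*-congˡ ρ*a≈q))
    (solve 10 (λ D a q ρ p r w₁ w₂ B₁ B₂ →
       D :* (ρ :* p :* (a :* w₁ :+ q :* w₂))
         :+ (ρ :* a :* (ρ :* r :* B₁) :+ q :* (r :* B₂)
         :+ (ρ :* r :* B₁ :- r :* B₂) :* q) :=
       ρ :* r :* (a :* B₂ :+ q :* B₁)
         :+ (ρ :* a :* (D :* (p :* w₁)) :+ q :* (D :* (ρ :* p :* w₂))
         :+ (ρ :* r :* B₁ :- r :* B₂) :* (ρ :* a)))
       D a q ρ (ρ ^ i) (ρ ^ j) (duration i (suc j)) (duration (suc i) j)
       (shortfall (suc j) i) (shortfall j (suc i)))

  win-diagonal : ∀ m → win (suc m) (suc m) ≈ first (suc m) (suc m) + first (suc m) (suc m)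
  win-diagonal m = *-cancelˡ-≈ (^-pos (suc m) 0<ρ)
    (trans (win-reflection (suc m) (suc m)) (sym (distribˡ _ _ _)))

  duration-diagonal : ∀ n → D * duration n n ≈ shortfall n n
  duration-diagonal n = *-cancelˡ-≈ (^-pos n 0<ρ)
    (trans (solve 3 (λ D r d → r :* (D :* d) := D :* (r :* d)) D (ρ ^ n) (duration n n))
      (duration-reflection n n))

  0<win : ∀ m → 0# < win (suc m) (suc m)
  0<win m = <-respʳ (sym (win-diagonal m)) (0<+ (0<first m (suc m)) (<⇒≤ (0<first m (suc m))))

  binomial-diagonal : ∀ m →
    binomial (suc m) (suc m) ≈ a * binomial m (suc m) + a * binomial m (suc m)
  binomial-diagonal m = *-cancelˡ-≈ (0<n·1 (suc m)) (trans (binomial-sucˡ m (suc m))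
    (trans (*-congʳ (×-homo-+ 1# (suc m) (suc m)))
      (solve 2 (λ n x → (n :+ n) :* x := n :* (x :+ x)) (suc m · 1#) (a * binomial m (suc m)))))

  binomial-diagonal-suc : ∀ n → suc n · 1# * binomial (suc n) (suc n) ≈
    (n · 1# + suc n · 1#) * (q * a + q * a) * binomial n n
  binomial-diagonal-suc n = linear-combination
    (+-cong (+-cong (*-congˡ (binomial-diagonal n)) (*-congˡ (binomial-sucʳ n n)))
            (*-congʳ (×-homo-+ 1# (suc n) n)))
    (solve 7 (λ a q n P b p M →
      (int 1 :+ n) :* P :+ ((int 1 :+ n) :* (a :* b :+ a :* b) :+ (a :+ a) :* (M :* (q :* p))
        :+ ((int 1 :+ n) :+ n) :* ((a :+ a) :* (q :* p))) :=
      (n :+ (int 1 :+ n)) :* (q :* a :+ q :* a) :* p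
        :+ ((int 1 :+ n) :* P :+ (a :+ a) :* ((int 1 :+ n) :* b) :+ M :* ((a :+ a) :* (q :* p))))
      a q (n · 1#) (binomial (suc n) (suc n)) (binomial n (suc n)) (binomial n n)
      ((suc n ℕ.+ n) · 1#))

  -- The two targets are raised one after the other. Raising that of B takes `f` to `F` and loses
  -- `a * b`, half of the central term `P`; raising that of G takes `F` to `F′` and gains `q * P`.
  -- Doubling gives the loss `D * P`.
  win-diagonal-suc : ∀ m → win (suc (suc m)) (suc (suc m)) ≈
    win (suc m) (suc m) - D * binomial (suc m) (suc m)
  win-diagonal-suc m = eliminate (win-diagonal (suc m)) (win-diagonal m) (binomial-diagonal m)
    refl refl (first-exchange (suc m) (suc m)) (first-exchange m (suc m))
    where
    eliminate : ∀ {W′ W P F′ F f f₂ g b} → W′ ≈ F′ + F′ → W ≈ f + f → P ≈ a * b + a * b →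
      F′ ≈ a * F + q * f₂ → F ≈ a * g + q * f → f₂ ≈ F + P → f ≈ g + b → W′ ≈ W - D * P
    eliminate {W′} {W} {P} {F′} {F} {f} {f₂} {g} {b} W′≈ W≈ P≈ F′≈ F≈ f₂≈ f≈ = linear-combination
      (+-cong (+-cong (+-cong W′≈ (sym W≈)) (+-cong P≈ (*-congˡ F′≈)))
              (+-cong (*-congˡ F≈) (+-cong (*-congˡ f₂≈) (*-congˡ (sym f≈)))))
      (solve 10 (λ q W′ W P F′ F f f₂ g b →
        let a = int 1 :- q in
        W′ :+ (F′ :+ F′ :+ W :+ (a :* b :+ a :* b :+ int 2 :* (a :* F :+ q :* f₂))
          :+ (int 2 :* (a :* g :+ q :* f) :+ (int 2 :* q :* (F :+ P) :+ int 2 :* a :* f))) :=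
        W :- (int 1 :- 2 :× q) :* P :+ (W′ :+ (f :+ f) :+ (P :+ int 2 :* F′)
          :+ (int 2 :* F :+ (int 2 :* q :* f₂ :+ int 2 :* a :* (g :+ b)))))
        q W′ W P F′ F f f₂ g b)

  -- For equal targets n the factor `i q - j a` in `q*shortfall` is `- n D`, twice `first` is `win`,
  -- and twice `corner` is n times the central binomial term.
  duration-win : ∀ m → let n = suc m in
    (q + q) * (D * duration n n) ≈ n · 1# * (binomial n n - D * win n n)
  duration-win m = eliminate (duration-diagonal (suc m)) (q*shortfall (suc m) (suc m)) refl
    (binomial-sucʳ m m) (binomial-diagonal m) (win-diagonal m)
    where
    eliminate : ∀ {d X n M W f P b p k} → D * d ≈ X → q * X ≈ (n * q - n * a) * f + k →
      k ≈ M * p * (q * a) → n * b ≈ M * (q * p) → P ≈ a * b + a * b → W ≈ f + f →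
      (q + q) * (D * d) ≈ n * (P - D * W)
    eliminate {d} {X} {n} {M} {W} {f} {P} {b} {p} {k} d≈ X≈ k≈ b≈ P≈ W≈ = linear-combination
      (+-cong (+-cong (+-cong (*-congˡ d≈) (*-congˡ X≈)) (*-congˡ k≈))
              (+-cong (*-congˡ (sym b≈)) (+-cong (*-congˡ (sym P≈)) (*-congˡ W≈))))
      (solve 11 (λ q d X n M W f P b p k →
        let a = int 1 :- q ; D = int 1 :- 2 :× q in
        (q :+ q) :* (D :* d)
          :+ ((q :+ q) :* X :+ int 2 :* ((n :* q :- n :* a) :* f :+ k) :+ int 2 :* (M :* p :* (q :* a))
          :+ (int 2 :* a :* (n :* b) :+ (n :* P :+ n :* D :* (f :+ f)))) :=
        n :* (P :- D :* W)
          :+ ((q :+ q) :* (D :* d) :+ int 2 :* (q :* X) :+ int 2 :* k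
          :+ (int 2 :* a :* (M :* (q :* p)) :+ (n :* (a :* b :+ a :* b) :+ n :* D :* W))))
        q d X n M W f P b p k)

-- The possible transitions of the game.

data AfterG (n g b : ℕ) : State → Set where
  goesOn    : suc g ℕ.< n → AfterG n g b (phaseI (suc g) b)
  bAhead    : suc g ≡ n → n ℕ.≤ b → AfterG n g b (bWins 0)
  bTrailing : suc g ≡ n → b ℕ.< n → AfterG n g b (phaseII n b 0)

afterG : ∀ n g b → g ℕ.< n → AfterG n g b (step n (phaseI g b) G)
afterG n g b g<n with suc g ℕ.≡ᵇ n | proof (suc g ℕ.≟ n)
... | false | ofⁿ 1+g≢n = goesOn (ℕ.≤∧≢⇒< g<n 1+g≢n)
... | true  | ofʸ 1+g≡n with n ℕ.≤ᵇ b | ℕ.≤ᵇ-reflects-≤ n b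
...   | true  | ofʸ n≤b = bAhead 1+g≡n n≤b
...   | false | ofⁿ n≰b = bTrailing 1+g≡n (ℕ.≰⇒> n≰b)

data AfterB (g b t : ℕ) : State → Set where
  ties   : suc b ≡ g → AfterB g b t (bWins (suc t))
  trails : suc b ℕ.< g → AfterB g b t (phaseII g (suc b) (suc t))

afterB : ∀ n g b t → b ℕ.< g → AfterB g b t (step n (phaseII g b t) B)
afterB n g b t b<g with suc b ℕ.≡ᵇ g | proof (suc b ℕ.≟ g)
... | false | ofⁿ 1+b≢g = trails (ℕ.≤∧≢⇒< b<g 1+b≢g)
... | true  | ofʸ 1+b≡g = ties 1+b≡g

Legal : ℕ → State → Set
Legal n (phaseI g b)    = g ℕ.< n
Legal n (phaseII g b t) = b ℕ.< g
Legal n (bWins t)       = ⊤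

legal-step : ∀ n σ x → Legal n σ → Legal n (step n σ x)
legal-step n (phaseI g b) G g<n with step n (phaseI g b) G | afterG n g b g<n
... | _ | goesOn 1+g<n    = 1+g<n
... | _ | bAhead _ _      = tt
... | _ | bTrailing _ b<n = b<n
legal-step n (phaseI g b)    B g<n = g<n
legal-step n (phaseII g b t) G b<g = ℕ.m<n⇒m<1+n b<g
legal-step n (phaseII g b t) B b<g with step n (phaseII g b t) B | afterB n g b t b<g
... | _ | ties _       = tt
... | _ | trails 1+b<g = 1+b<g
legal-step n (bWins t) x _ = tt

m<n⇒n∸m≡1+[n∸[1+m]] : ∀ {m n} → m ℕ.< n → n ∸ m ≡ suc (n ∸ suc m)
m<n⇒n∸m≡1+[n∸[1+m]] = ℕ.+-∸-assoc 1

-- Convergence of the expectations over finitely many goals.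

module GameValue {c ℓ₁ ℓ₂} (ℝ : RealNumbers c ℓ₁ ℓ₂) (β : Bias (RealNumbers.orderedField ℝ)) where
  open RealNumbers ℝ hiding (zero)
  open OrderedFieldProperties orderedField
  open IntegerSolver commutativeRing
  open WinningOdds orderedField β public
  open TwoPhaseGame ℝ
  open Exp commutativeSemiring using (^-distrib-*; ^-congˡ)

  -- Bernoulli's inequality bounds the power by 1 / (1 + L η), so any natural number above b / (ε η)
  -- serves as threshold.
  geometric-null : ∀ {η b} → 0# < η → 0# ≤ 1# - η → 0# ≤ b → ∀ ε → 0# < ε →
    ∃[ N ] ∀ L → N ℕ.≤ L → (1# - η) ^ L * b < ε
  geometric-null {η} {b} 0<η 0≤1-η 0≤b ε 0<ε with archimedean (b / ε * η [ *-pos 0<ε 0<η ])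
  ... | N , b/εη<N = N , λ L N≤L → *-cancelˡ-< (0<+ 0<1 (*-nonneg (0≤n·1 L) (<⇒≤ 0<η))) (begin-strict
    (1# + L · 1# * η) * ((1# - η) ^ L * b)
      ≈⟨ solve 3 (λ x y b → x :* (y :* b) := b :* (y :* x)) (1# + L · 1# * η) ((1# - η) ^ L) b ⟩
    b * ((1# - η) ^ L * (1# + L · 1# * η))
      ≤⟨ *-monoˡ-≤ 0≤b (bernoulli (<⇒≤ 0<η) 0≤1-η L) ⟩
    b * 1#
      ≈⟨ trans (*-identityʳ b) (sym (y*[x/y]≈x b (*-pos 0<ε 0<η))) ⟩
    ε * η * (b / ε * η [ *-pos 0<ε 0<η ])
      <⟨ *-monoˡ-< (*-pos 0<ε 0<η) b/εη<N ⟩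
    ε * η * (N · 1#)
      ≤⟨ *-monoˡ-≤ (<⇒≤ (*-pos 0<ε 0<η)) (·-mono-≤ N≤L) ⟩
    ε * η * (L · 1#)
      ≤⟨ 0≤d⇒x≤x+d (<⇒≤ 0<ε)
           (solve 3 (λ ε η l → (int 1 :+ l :* η) :* ε := ε :* η :* l :+ ε) ε η (L · 1#)) ⟩
    (1# + L · 1# * η) * ε ∎)
    where open ≤-Reasoning

  0≤q : 0# ≤ q
  0≤q = <⇒≤ 0<q

  0≤a : 0# ≤ a
  0≤a = <⇒≤ 0<1-q

  ½ : Carrier
  ½ = a * u

  ½+½≈1 : ½ + ½ ≈ 1#
  ½+½≈1 = trans (sym (distribʳ u a a)) 2a*u≈1

  0<½ : 0# < ½
  0<½ = *-pos 0<1-q 0<u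

  -- With 4 η = (1 - 2q)², the function `potential` below shrinks on average by
  -- the factor 1 - η at every goal, as long as B has not won.
  η : Carrier
  η = D * D * (½ * ½)

  κ : Carrier
  κ = (δ + δ) * (δ + δ)

  0<η : 0# < η
  0<η = *-pos (*-pos 0<D 0<D) (*-pos 0<½ 0<½)

  0<κ : 0# < κ
  0<κ = *-pos 0<δ+δ 0<δ+δ
    where 0<δ+δ = 0<+ 0<δ (<⇒≤ 0<δ)

  η*κ≈1 : η * κ ≈ 1#
  η*κ≈1 = begin
    η * κ
      ≈⟨ solve 3 (λ D h δ → D :* D :* (h :* h) :* ((δ :+ δ) :* (δ :+ δ)) :=
           (D :* δ) :* (D :* δ) :* ((h :+ h) :* (h :+ h))) D ½ δ ⟩
    (D * δ) * (D * δ) * ((½ + ½) * (½ + ½))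
      ≈⟨ *-cong (*-cong D*δ≈1 D*δ≈1) (*-cong ½+½≈1 ½+½≈1) ⟩
    1# * 1# * (1# * 1#)
      ≈⟨ solve 0 (int 1 :* int 1 :* (int 1 :* int 1) := int 1) ⟩
    1# ∎
    where open ≈-Reasoning setoid

  D≤1 : D ≤ 1#
  D≤1 = 0≤d⇒x≤x+d (0≤+ 0≤q 0≤q) (solve 1 (λ q → int 1 := int 1 :- 2 :× q :+ (q :+ q)) q)

  -- Because D² = 1 - 4 q a, the difference is half of D + 4 q a.
  0≤a-2η : 0# ≤ a - (η + η)
  0≤a-2η = ≤-respʳ (sym (linear-combination
      (*-congˡ (sym ½+½≈1))
      (solve 2 (λ q h → let a = int 1 :- q ; D = int 1 :- 2 :× q ; η = D :* D :* (h :* h) in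
        a :- (η :+ η) :+ (a :+ D :* D :* h) :* (h :+ h) :=
        h :* (D :+ (4 :× int 1) :* (q :* a)) :+ (a :+ D :* D :* h) :* int 1)
        q ½)))
    (*-nonneg (<⇒≤ 0<½) (0≤+ (<⇒≤ 0<D) (*-nonneg (0≤n·1 4) (*-nonneg 0≤q 0≤a))))

  η≤a : η ≤ a
  η≤a = 0≤d⇒x≤x+d (0≤+ 0≤a-2η (<⇒≤ 0<η)) (solve 2 (λ a η → a := η :+ (a :- (η :+ η) :+ η)) a η)

  0≤1-η : 0# ≤ 1# - η
  0≤1-η = x≤y⇒0≤y-x (≤-trans η≤a (0≤d⇒x≤x+d 0≤q (solve 1 (λ q → int 1 := int 1 :- q :+ q) q)))

  u≤1 : u ≤ 1#
  u≤1 = 0≤d⇒x≤x+d (<⇒≤ (*-pos 0<D 0<u)) (trans (sym 2a*u≈1)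
    (solve 2 (λ q u → (int 1 :- q :+ (int 1 :- q)) :* u := u :+ (int 1 :- 2 :× q) :* u) q u))

  1≤δ : 1# ≤ δ
  1≤δ = 0≤d⇒x≤x+d (*-nonneg (0≤+ 0≤q 0≤q) (<⇒≤ 0<δ)) (linear-combination D*δ≈1
    (solve 2 (λ q δ → δ :+ int 1 := int 1 :+ (q :+ q) :* δ :+ (int 1 :- 2 :× q) :* δ) q δ))

  δ²≤κ : δ * δ ≤ κ
  δ²≤κ = 0≤d⇒x≤x+d (*-nonneg (0≤n·1 3) (*-nonneg (<⇒≤ 0<δ) (<⇒≤ 0<δ)))
    (solve 1 (λ δ → (δ :+ δ) :* (δ :+ δ) := δ :* δ :+ (3 :× int 1) :* (δ :* δ)) δ)

  1≤κ : 1# ≤ κ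
  1≤κ = ≤-trans (≤-respˡ (*-identityˡ 1#) (*-mono-≤ 0≤1 (<⇒≤ 0<δ) 1≤δ 1≤δ)) δ²≤κ

  -- In Phase I a goal of B changes nothing, so a goal of G has to halve the potential. In Phase II
  -- the power of `u` contributes the average factor `1 - 2 η` per goal; the growth of `t + κ` by
  -- one costs at most a factor `1 + η`, as `κ` is the inverse of `η`, and `1 - η` remains. The
  -- summand t lets the potential dominate the elapsed duration.
  potential : ℕ → State → Carrier
  potential n (phaseI g b)    = (1# + 1#) ^ (n ∸ g) * κ
  potential n (phaseII g b t) = u ^ (g ∸ b) * (t · 1# + κ)
  potential n (bWins t)       = 0#

  0≤t+κ : ∀ t → 0# ≤ t · 1# + κ
  0≤t+κ t = 0≤+ (0≤n·1 t) (<⇒≤ 0<κ)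

  u^k*κ≤κ : ∀ k → u ^ k * (0 · 1# + κ) ≤ κ
  u^k*κ≤κ k = ≤-respʳ (solve 1 (λ κ → int 1 :* (int 0 :+ κ) := κ) κ)
    (*-monoʳ-≤ (0≤t+κ 0) (^≤1 k (<⇒≤ 0<u) u≤1))

  1≤2^i : ∀ i → 1# ≤ (1# + 1#) ^ i
  1≤2^i zero    = ≤-refl
  1≤2^i (suc i) = ≤-trans (1≤2^i i) (0≤d⇒x≤x+d (^-nonneg i (0≤+ 0≤1 0≤1))
    (solve 1 (λ x → (int 1 :+ int 1) :* x := x :+ x) ((1# + 1#) ^ i)))

  κ≤2^i*κ : ∀ i → κ ≤ (1# + 1#) ^ i * κ
  κ≤2^i*κ i = ≤-respˡ (*-identityˡ κ) (*-monoʳ-≤ (<⇒≤ 0<κ) (1≤2^i i))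

  a*u²+q≈ : a * (u * u) + q ≈ u * (1# - (η + η))
  a*u²+q≈ = linear-combination (*-congˡ 2a*u≈1)
    (solve 2 (λ q u →
      let a = int 1 :- q ; D = int 1 :- 2 :× q ; h = a :* u ; η = D :* D :* (h :* h)
          m = u :- q :+ D :* D :* (a :* (u :* u)) :- (q :+ q) :* h in
      a :* (u :* u) :+ q :+ m :* int 1 := u :* (int 1 :- (η :+ η)) :+ m :* ((a :+ a) :* u))
      q u)

  phaseI-contracts : ∀ {x y} → 0# ≤ y → x ≤ y →
    a * x + q * ((1# + 1#) * y) ≤ (1# - η) * ((1# + 1#) * y)
  phaseI-contracts {x} {y} 0≤y x≤y = ≤-trans (+-mono-≤ (*-monoˡ-≤ 0≤a x≤y) ≤-refl)
    (0≤d⇒x≤x+d (*-nonneg 0≤a-2η 0≤y)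
      (solve 3 (λ q η y → (int 1 :- η) :* ((int 1 :+ int 1) :* y) :=
         (int 1 :- q) :* y :+ q :* ((int 1 :+ int 1) :* y) :+ (int 1 :- q :- (η :+ η)) :* y) q η y))

  phaseII-contracts : ∀ {x U T} → 0# ≤ U → 0# ≤ T → x ≤ U * (1# + T + κ) →
    a * (u * (u * U) * (1# + T + κ)) + q * x ≤ (1# - η) * (u * U * (T + κ))
  phaseII-contracts {x} {U} {T} 0≤U 0≤T x≤ = ≤-trans (+-mono-≤ ≤-refl (*-monoˡ-≤ 0≤q x≤))
    (0≤d⇒x≤x+d (*-nonneg (*-nonneg (<⇒≤ 0<u) 0≤U) (*-nonneg (<⇒≤ 0<η) (0≤+ 0≤T (0≤n·1 2))))
      (linear-combination (+-cong (*-congˡ {U * (1# + T + κ)} (sym a*u²+q≈)) (*-congˡ {u * U} η*κ≈1))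
        (solve 7 (λ a q u η κ U T →
          (int 1 :- η) :* (u :* U :* (T :+ κ))
            :+ (U :* (int 1 :+ T :+ κ) :* (a :* (u :* u) :+ q) :+ u :* U :* int 1) :=
          a :* (u :* (u :* U) :* (int 1 :+ T :+ κ)) :+ q :* (U :* (int 1 :+ T :+ κ))
            :+ u :* U :* (η :* (T :+ 2 :× int 1))
            :+ (U :* (int 1 :+ T :+ κ) :* (u :* (int 1 :- (η :+ η))) :+ u :* U :* (η :* κ)))
          a q u η κ U T)))

  potential-afterG : ∀ {n g b σ} → AfterG n g b σ → potential n σ ≤ (1# + 1#) ^ (n ∸ suc g) * κ
  potential-afterG             (goesOn _)      = ≤-refl
  potential-afterG {n} {g}     (bAhead _ _)    = ≤-trans (<⇒≤ 0<κ) (κ≤2^i*κ (n ∸ suc g))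
  potential-afterG {n} {g} {b} (bTrailing _ _) = ≤-trans (u^k*κ≤κ (n ∸ b)) (κ≤2^i*κ (n ∸ suc g))

  potential-afterB : ∀ {n g b t σ} → AfterB g b t σ →
    potential n σ ≤ u ^ (g ∸ suc b) * (1# + t · 1# + κ)
  potential-afterB {g = g} {b} {t} (ties _) = *-nonneg (^-nonneg (g ∸ suc b) (<⇒≤ 0<u)) (0≤t+κ (suc t))
  potential-afterB (trails _) = ≤-refl

  phaseI-step : ∀ {k i x} → k ≡ suc i → x ≤ (1# + 1#) ^ i * κ →
    a * x + q * ((1# + 1#) ^ k * κ) ≤ (1# - η) * ((1# + 1#) ^ k * κ)
  phaseI-step {i = i} ≡.refl x≤ =
    ≤-respʳ (*-congˡ (sym (*-assoc _ _ _))) (≤-respˡ (+-congˡ (*-congˡ (sym (*-assoc _ _ _))))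
      (phaseI-contracts (≤-trans (<⇒≤ 0<κ) (κ≤2^i*κ i)) x≤))

  phaseII-step : ∀ {l k i t x} → l ≡ suc k → k ≡ suc i → x ≤ u ^ i * (1# + t · 1# + κ) →
    a * (u ^ l * (1# + t · 1# + κ)) + q * x ≤ (1# - η) * (u ^ k * (t · 1# + κ))
  phaseII-step {i = i} {t} ≡.refl ≡.refl x≤ =
    phaseII-contracts (^-nonneg i (<⇒≤ 0<u)) (0≤n·1 t) x≤

  potential-step : ∀ n σ → Legal n σ →
    a * potential n (step n σ G) + q * potential n (step n σ B) ≤ (1# - η) * potential n σ
  potential-step n (phaseI g b) g<n =
    phaseI-step (m<n⇒n∸m≡1+[n∸[1+m]] g<n) (potential-afterG (afterG n g b g<n))
  potential-step n (phaseII g b t) b<g =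
    phaseII-step {t = t} (ℕ.+-∸-assoc 1 (ℕ.<⇒≤ b<g)) (m<n⇒n∸m≡1+[n∸[1+m]] b<g)
      (potential-afterB {n} {g} {b} {t} (afterB n g b t b<g))
  potential-step n (bWins t) _ = ≤-reflexive
    (solve 3 (λ a q η → a :* int 0 :+ q :* int 0 := (int 1 :- η) :* int 0) a q η)

  -- w k t is the expected payoff when Phase II has lasted t goals and B trails by k.
  module Value
    (w        : ℕ → ℕ → Carrier)
    (harmonic : ∀ k t → w (suc k) t ≈ a * w (suc (suc k)) (suc t) + q * w k (suc t))
    (nonneg   : ∀ k t → 0# ≤ w k t)
    (bounded  : ∀ k t → w k t ≤ u ^ k * (t · 1# + κ))
    (payoff   : State → Carrier)
    (payoff-phaseI  : ∀ g b → payoff (phaseI g b) ≈ 0#)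
    (payoff-phaseII : ∀ g b t → payoff (phaseII g b t) ≈ 0#)
    (payoff-bWins   : ∀ t → payoff (bWins t) ≈ w 0 t)
    (n : ℕ)
    where

    value : State → Carrier
    value (phaseI g b)    = valueI w (n ∸ g) (n ∸ b)
    value (phaseII g b t) = w (g ∸ b) t
    value (bWins t)       = w 0 t

    average : ∀ x → x ≈ a * x + q * x
    average = solve 2 (λ q x → x := (int 1 :- q) :* x :+ q :* x) q

    valueI-suc : ∀ i j → valueI w (suc i) j ≈ a * valueI w i j + q * valueI w (suc i) (pred j)
    -- B has reached its target and wins at the end of Phase I, so the value stays `w 0 0` whoever
    -- scores; `pred` keeps the target at 0.
    valueI-suc i zero    = average _
    valueI-suc i (suc j) = refl

    value-afterG : ∀ {g b σ} → AfterG n g b σ → valueI w (n ∸ suc g) (n ∸ b) ≡ value σ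
    value-afterG (goesOn _)               = ≡.refl
    value-afterG (bAhead ≡.refl n≤b)      = ≡.cong (valueI w _) (ℕ.m≤n⇒m∸n≡0 n≤b)
    value-afterG {g} {b} (bTrailing ≡.refl b<n) = trailing (ℕ.n∸n≡0 g) (m<n⇒n∸m≡1+[n∸[1+m]] b<n)
      where
      trailing : ∀ {i j k} → i ≡ 0 → j ≡ suc k → valueI w i j ≡ w j 0
      trailing ≡.refl ≡.refl = ≡.refl

    value-afterB : ∀ {g b t σ} → AfterB g b t σ → w (g ∸ suc b) (suc t) ≡ value σ
    value-afterB {b = b} {t} (ties ≡.refl) = ≡.cong (λ k → w k (suc t)) (ℕ.n∸n≡0 b)
    value-afterB (trails _)                = ≡.refl

    value-phaseI : ∀ {k i j l} → k ≡ suc i → pred j ≡ l →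
      valueI w k j ≈ a * valueI w i j + q * valueI w k l
    value-phaseI {i = i} {j} ≡.refl ≡.refl = valueI-suc i j

    value-phaseII : ∀ {l k i t} → l ≡ suc k → k ≡ suc i → w k t ≈ a * w l (suc t) + q * w i (suc t)
    value-phaseII {i = i} {t} ≡.refl ≡.refl = harmonic i t

    value-step : ∀ σ → Legal n σ → value σ ≈ a * value (step n σ G) + q * value (step n σ B)
    value-step (phaseI g b) g<n = trans
      (value-phaseI {j = n ∸ b} (m<n⇒n∸m≡1+[n∸[1+m]] g<n) (ℕ.pred[m∸n]≡m∸[1+n] n b))
      (+-congʳ (*-congˡ (reflexive (value-afterG (afterG n g b g<n)))))
    value-step (phaseII g b t) b<g = trans
      (value-phaseII (ℕ.+-∸-assoc 1 (ℕ.<⇒≤ b<g)) (m<n⇒n∸m≡1+[n∸[1+m]] b<g))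
      (+-congˡ (*-congˡ (reflexive (value-afterB (afterB n g b t b<g)))))
    value-step (bWins t) _ = average _

    value-bounds : ∀ σ → (payoff σ ≤ value σ) × (value σ ≤ payoff σ + potential n σ)
    value-bounds (phaseI g b) =
      ≤-respˡ (sym (payoff-phaseI g b)) (proj₁ V) ,
      ≤-respʳ (trans (sym (+-identityˡ _)) (+-congʳ (sym (payoff-phaseI g b))))
        (≤-trans (proj₂ V) (κ≤2^i*κ (n ∸ g)))
      where
      w≤κ : ∀ k → w k 0 ≤ κ
      w≤κ k = ≤-trans (bounded k 0) (u^k*κ≤κ k)
      V = expected-bounds {λ k → w k 0} {λ _ → w 0 0}
        (λ k → nonneg k 0 , w≤κ k) (λ _ → nonneg 0 0 , w≤κ 0) (n ∸ g) (n ∸ b)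
    value-bounds (phaseII g b t) =
      ≤-respˡ (sym (payoff-phaseII g b t)) (nonneg (g ∸ b) t) ,
      ≤-respʳ (trans (sym (+-identityˡ _)) (+-congʳ (sym (payoff-phaseII g b t))))
        (bounded (g ∸ b) t)
    value-bounds (bWins t) =
      ≤-reflexive (payoff-bWins t) ,
      ≤-reflexive (trans (sym (payoff-bWins t)) (sym (+-identityʳ _)))

    𝔼-payoff : ℕ → State → Carrier
    𝔼-payoff L σ = 𝔼 q L (λ goals → payoff (foldl (step n) σ goals))

    -- The value is preserved on average by a goal and exceeds the payoff by at most the potential.
    -- Each further goal multiplies this allowance by at most `1 - η`.
    𝔼-bounds : ∀ L σ → Legal n σ →
      (𝔼-payoff L σ ≤ value σ) × (value σ ≤ 𝔼-payoff L σ + (1# - η) ^ L * potential n σ)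
    𝔼-bounds zero    σ legal =
      proj₁ (value-bounds σ) , ≤-respʳ (+-congˡ (sym (*-identityˡ _))) (proj₂ (value-bounds σ))
    𝔼-bounds (suc L) σ legal = lower , upper
      where
      IH-G = 𝔼-bounds L (step n σ G) (legal-step n σ G legal)
      IH-B = 𝔼-bounds L (step n σ B) (legal-step n σ B legal)
      lower : 𝔼-payoff (suc L) σ ≤ value σ
      lower = ≤-respʳ (sym (value-step σ legal))
        (+-mono-≤ (*-monoˡ-≤ 0≤a (proj₁ IH-G)) (*-monoˡ-≤ 0≤q (proj₁ IH-B)))
      open ≤-Reasoning
      upper : value σ ≤ 𝔼-payoff (suc L) σ + (1# - η) ^ suc L * potential n σ
      upper = begin
        value σ
          ≈⟨ value-step σ legal ⟩
        a * value (step n σ G) + q * value (step n σ B)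
          ≤⟨ +-mono-≤ (*-monoˡ-≤ 0≤a (proj₂ IH-G)) (*-monoˡ-≤ 0≤q (proj₂ IH-B)) ⟩
        a * (𝔼-payoff L (step n σ G) + (1# - η) ^ L * potential n (step n σ G)) +
        q * (𝔼-payoff L (step n σ B) + (1# - η) ^ L * potential n (step n σ B))
          ≈⟨ solve 7 (λ a q v w θ x y → a :* (v :+ θ :* x) :+ q :* (w :+ θ :* y) :=
               a :* v :+ q :* w :+ θ :* (a :* x :+ q :* y))
               a q (𝔼-payoff L (step n σ G)) (𝔼-payoff L (step n σ B)) ((1# - η) ^ L)
               (potential n (step n σ G)) (potential n (step n σ B)) ⟩
        𝔼-payoff (suc L) σ +
        (1# - η) ^ L * (a * potential n (step n σ G) + q * potential n (step n σ B))
          ≤⟨ +-mono-≤ ≤-refl (*-monoˡ-≤ (^-nonneg L 0≤1-η) (potential-step n σ legal)) ⟩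
        𝔼-payoff (suc L) σ + (1# - η) ^ L * ((1# - η) * potential n σ)
          ≈⟨ +-congˡ (solve 3 (λ θ x y → x :* (θ :* y) := θ :* x :* y)
               (1# - η) ((1# - η) ^ L) (potential n σ)) ⟩
        𝔼-payoff (suc L) σ + (1# - η) ^ suc L * potential n σ ∎

    𝔼-payoff⟶value : 0 ℕ.< n → (λ L → 𝔼 q L (λ goals → payoff (play n goals))) ⟶ valueI w n n
    𝔼-payoff⟶value 0<n ε 0<ε = N , λ L N≤L →
      (≤-<-trans (proj₁ (bounds L)) (0<d⇒x<x+d 0<ε refl)) ,
      (≤-<-trans (proj₂ (bounds L)) (<-respˡ (+-comm _ _) (<-respʳ (+-comm _ _)
        (+-monoˡ-< _ (small L N≤L)))))
      where
      bounds = λ L → 𝔼-bounds L (phaseI 0 0) 0<n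
      null = geometric-null 0<η 0≤1-η (≤-trans (<⇒≤ 0<κ) (κ≤2^i*κ n)) ε 0<ε
      N = proj₁ null
      small = proj₂ null

  u^k≤potential : ∀ {T} k → 0# ≤ T → u ^ k ≤ u ^ k * (T + κ)
  u^k≤potential k 0≤T = ≤-respˡ (*-identityʳ _) (*-monoˡ-≤ (^-nonneg k (<⇒≤ 0<u))
    (≤-trans 1≤κ (0≤d⇒x≤x+d 0≤T (+-comm _ _))))

  0≤2q : 0# ≤ q + q
  0≤2q = 0≤+ 0≤q 0≤q

  2q≤1 : q + q ≤ 1#
  2q≤1 = 0≤d⇒x≤x+d (<⇒≤ 0<D) (solve 1 (λ q → int 1 := q :+ q :+ (int 1 :- 2 :× q)) q)

  ρ^k≈ : ∀ k → ρ ^ k ≈ u ^ k * (q + q) ^ k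
  ρ^k≈ k = trans (^-distrib-* (q + q) u k) (*-comm _ _)

  -- Since 2 q = 1 - D, this is Bernoulli's inequality. In `ρ ^ k = u ^ k * (q + q) ^ k` the second
  -- power thus absorbs the factor k of the remaining duration.
  [2q]^k*k≤δ : ∀ k → (q + q) ^ k * (k · 1#) ≤ δ
  [2q]^k*k≤δ k = *-cancelˡ-≤ 0<D (≤-respʳ (sym D*δ≈1) (begin
    D * ((q + q) ^ k * (k · 1#))
      ≤⟨ 0≤d⇒x≤x+d (^-nonneg k 0≤2q)
           (solve 3 (λ D y k → y :* (int 1 :+ k :* D) := D :* (y :* k) :+ y) D ((q + q) ^ k) (k · 1#)) ⟩
    (q + q) ^ k * (1# + k · 1# * D)
      ≈⟨ *-congʳ (^-congˡ k (solve 1 (λ q → q :+ q := int 1 :- (int 1 :- 2 :× q)) q)) ⟩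
    (1# - D) ^ k * (1# + k · 1# * D)
      ≤⟨ bernoulli (<⇒≤ 0<D) (x≤y⇒0≤y-x D≤1) k ⟩
    1# ∎))
    where open ≤-Reasoning

  winReward-harmonic : ∀ k t →
    winReward (suc k) t ≈ a * winReward (suc (suc k)) (suc t) + q * winReward k (suc t)
  winReward-harmonic k t = linear-combination (*-congˡ ρ*a≈q)
    (solve 3 (λ q ρ p → let a = int 1 :- q in
      ρ :* p :+ (p :- p :* ρ) :* q :=
      a :* (ρ :* (ρ :* p)) :+ q :* p :+ (p :- p :* ρ) :* (ρ :* a)) q ρ (ρ ^ k))

  -- By `ρ * a ≈ q` the weights of the two outcomes, relative to `ρ ^ suc k`, are q for falling
  -- further behind and a for catching up. Hence k δ drops by D δ = 1 on average, just what t gains.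
  durationReward-harmonic : ∀ k t → durationReward (suc k) t ≈
    a * durationReward (suc (suc k)) (suc t) + q * durationReward k (suc t)
  durationReward-harmonic k t = linear-combination (+-cong (*-congˡ ρ*a≈q) (*-congˡ D*δ≈1))
    (solve 6 (λ q ρ δ p k t →
      let a = int 1 :- q ; D = int 1 :- 2 :× q ; T = t :+ (int 1 :+ k) :* δ
          m = p :* (T :+ int 1 :- δ :- ρ :* (T :+ int 1 :+ δ)) in
      ρ :* p :* (t :+ (int 1 :+ k) :* δ) :+ (m :* q :+ p :* ρ :* int 1) :=
      a :* (ρ :* (ρ :* p) :* (int 1 :+ t :+ (int 1 :+ (int 1 :+ k)) :* δ))
        :+ q :* (p :* (int 1 :+ t :+ k :* δ)) :+ (m :* (ρ :* a) :+ p :* ρ :* (D :* δ)))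
      q ρ δ (ρ ^ k) (k · 1#) (t · 1#))

  durationReward-bounded : ∀ k t → durationReward k t ≤ u ^ k * (t · 1# + κ)
  durationReward-bounded k t = begin
    ρ ^ k * (t · 1# + k · 1# * δ)
      ≈⟨ trans (*-congʳ (ρ^k≈ k)) (solve 5 (λ u y t k δ → u :* y :* (t :+ k :* δ) :=
           u :* (y :* t :+ δ :* (y :* k))) (u ^ k) ((q + q) ^ k) (t · 1#) (k · 1#) δ) ⟩
    u ^ k * ((q + q) ^ k * (t · 1#) + δ * ((q + q) ^ k * (k · 1#)))
      ≤⟨ *-monoˡ-≤ (^-nonneg k (<⇒≤ 0<u)) (+-mono-≤
           (≤-respʳ (*-identityˡ _) (*-monoʳ-≤ (0≤n·1 t) (^≤1 k 0≤2q 2q≤1)))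
           (≤-trans (*-monoˡ-≤ (<⇒≤ 0<δ) ([2q]^k*k≤δ k)) δ²≤κ)) ⟩
    u ^ k * (t · 1# + κ) ∎
    where open ≤-Reasoning

  module Win n = Value winReward winReward-harmonic (λ k _ → ^-nonneg k (<⇒≤ 0<ρ))
    (λ k t → ≤-trans (≤-respˡ (sym (ρ^k≈ k)) (≤-respʳ (*-identityʳ _)
      (*-monoˡ-≤ (^-nonneg k (<⇒≤ 0<u)) (^≤1 k 0≤2q 2q≤1)))) (u^k≤potential k (0≤n·1 t)))
    𝟙[bWins] (λ _ _ → refl) (λ _ _ _ → refl) (λ _ → refl) n

  module Duration n = Value durationReward durationReward-harmonic
    (λ k t → *-nonneg (^-nonneg k (<⇒≤ 0<ρ)) (0≤+ (0≤n·1 t) (*-nonneg (0≤n·1 k) (<⇒≤ 0<δ))))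
    durationReward-bounded duration*𝟙[bWins] (λ _ _ → refl) (λ _ _ _ → refl)
    (λ t → solve 2 (λ t δ → t := int 1 :* (t :+ int 0 :* δ)) (t · 1#) δ) n

  conditionalDuration : ℕ → Carrier
  conditionalDuration m = duration (suc m) (suc m) / win (suc m) (suc m) [ 0<win m ]

  conditionalDuration-correct : ∀ m → IsConditionalExpectation q (suc m) (conditionalDuration m)
  conditionalDuration-correct m =
    duration (suc m) (suc m) , win (suc m) (suc m) , 0<win m ,
    Duration.𝔼-payoff⟶value (suc m) ℕ.z<s , Win.𝔼-payoff⟶value (suc m) ℕ.z<s , refl

-- Orders of vanishing read off from polynomial normal forms.

module PolynomialBounds {c ℓ₁ ℓ₂} (ℝ : RealNumbers c ℓ₁ ℓ₂) where
  open RealNumbers ℝ hiding (zero)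
  open OrderedFieldProperties orderedField
  open IntegerSolver commutativeRing
  open Exp commutativeSemiring using (^-congˡ)

  constant-bound : ∀ x → ∃[ b ] ∣ x ∣≤ b
  constant-bound x with archimedean x | archimedean (- x)
  ... | m , x<m | n , -x<n = m · 1# + n · 1# ,
    0≤d⇒x≤x+d (0≤+ (0≤n·1 m) (<⇒≤ (x<y⇒0<y-x -x<n)))
      (solve 3 (λ x m n → x := :- (m :+ n) :+ (m :+ (n :- :- x))) x (m · 1#) (n · 1#)) ,
    0≤d⇒x≤x+d (0≤+ (<⇒≤ (x<y⇒0<y-x x<m)) (0≤n·1 n))
      (solve 3 (λ x m n → m :+ n := x :+ (m :- x :+ n)) x (m · 1#) (n · 1#))

  infix 4 _=O[_^_]
  _=O[_^_] : (ℕ → Carrier) → (ℕ → Carrier) → ℕ → Set _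
  f =O[ x ^ k ] = ∃[ b ] ∀ m → ∣ f m ∣≤ b * x m ^ k

  Bounded : (ℕ → Carrier) → Set _
  Bounded f = ∃[ b ] ∀ m → ∣ f m ∣≤ b

  data BoundedEnv : ∀ {n} → (ℕ → Env n) → Set (c ⊔ ℓ₂) where
    []  : BoundedEnv (λ _ → [])
    _∷_ : ∀ {n x} {ρ : ℕ → Env n} → Bounded x → BoundedEnv ρ → BoundedEnv (λ m → x m ∷ ρ m)

  mutual
    bounded-HNF : ∀ {n} (p : HNF (suc n)) {ρ} → BoundedEnv ρ → Bounded (λ m → ⟦ p ⟧H (ρ m))
    bounded-HNF ∅         _          = 0# , λ _ → nonneg⇒∣∣≤ ≤-refl ≤-refl
    bounded-HNF (p *x+ c) (bx ∷ bρ) with bounded-HNF p (bx ∷ bρ) | bx | bounded-Normal c bρ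
    ... | b₁ , ∣p∣≤b₁ | b₂ , ∣x∣≤b₂ | b₃ , ∣c∣≤b₃ =
      b₁ * b₂ + b₃ , λ m → ∣+∣≤ (∣*∣≤ (∣p∣≤b₁ m) (∣x∣≤b₂ m)) (∣c∣≤b₃ m)

    bounded-Normal : ∀ {n} (p : Normal n) {ρ} → BoundedEnv ρ → Bounded (λ m → ⟦ p ⟧N (ρ m))
    bounded-Normal (con i)  _  = proj₁ (constant-bound _) , λ _ → proj₂ (constant-bound _)
    bounded-Normal (poly p) bρ = bounded-HNF p bρ

  -- x ^ k divides p, where x is the main variable of p.
  data Divisible {n} : ℕ → HNF (suc n) → Set (c ⊔ ℓ₁) where
    any   : ∀ {p} → Divisible 0 p
    ∅     : ∀ {k} → Divisible k ∅
    shift : ∀ {k p c} → c ≈N 0N → Divisible k p → Divisible (suc k) (p *x+ c)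

  divisible? : ∀ {n} k (p : HNF (suc n)) → Maybe (Divisible k p)
  divisible? zero    p         = just any
  divisible? (suc k) ∅         = just ∅
  divisible? (suc k) (p *x+ c) = Maybe.zipWith shift (c ≟N 0N) (divisible? k p)

  divisible⇒=O : ∀ {n k} {p : HNF (suc n)} {x} {ρ : ℕ → Env n} → Divisible k p →
    (∀ m → 0# ≤ x m) → Bounded x → BoundedEnv ρ → (λ m → ⟦ p ⟧H (x m ∷ ρ m)) =O[ x ^ k ]
  divisible⇒=O {p = p} any 0≤x bx bρ with bounded-HNF p (bx ∷ bρ)
  ... | b , ∣p∣≤b = b , λ m → ∣∣≤-trans (∣p∣≤b m) (≤-reflexive (sym (*-identityʳ b)))
  divisible⇒=O {k = k} {x = x} ∅ 0≤x bx bρ =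
    0# , λ m → nonneg⇒∣∣≤ ≤-refl (≤-reflexive (sym (zeroˡ (x m ^ k))))
  divisible⇒=O {p = p *x+ c} {x} {ρ} (shift {k} c≈0 div) 0≤x bx bρ with divisible⇒=O div 0≤x bx bρ
  ... | b , ∣p∣≤ = b , λ m → ∣∣≤-trans
    (∣∣≤-resp (trans (*-comm _ _) (trans (sym (+-identityʳ _)) (+-congˡ (0≈⟦0⟧ c≈0 (ρ m)))))
      (*-∣∣≤ (0≤x m) (∣p∣≤ m)))
    (≤-reflexive (solve 3 (λ x b p → x :* (b :* p) := b :* (x :* p)) (x m) b (x m ^ k)))

  hnf : ∀ {n} → Normal (suc n) → HNF (suc n)
  hnf (poly p) = p

  ⟦hnf⟧ : ∀ {n} (p : Normal (suc n)) ρ → ⟦ hnf p ⟧H ρ ≈ ⟦ p ⟧N ρ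
  ⟦hnf⟧ (poly p) ρ = refl

  -- The implicit argument checks by computation that the k lowest coefficients of the Horner form
  -- in the first variable vanish. The cofactor of the k-th power is a polynomial in bounded
  -- quantities, hence bounded.
  polynomial-order : ∀ {n} k (p : Polynomial (suc n)) {x} {ρ : ℕ → Env n} →
    {T (is-just (divisible? k (hnf (normalise p))))} →
    (∀ m → 0# ≤ x m) → Bounded x → BoundedEnv ρ → (λ m → ⟦ p ⟧ (x m ∷ ρ m)) =O[ x ^ k ]
  polynomial-order k p {x} {ρ} {div} 0≤x bx bρ =
    proj₁ bound , λ m → ∣∣≤-resp (trans (⟦hnf⟧ (normalise p) _) (correct p (x m ∷ ρ m))) (proj₂ bound m)
    where bound = divisible⇒=O (to-witness-T (divisible? k (hnf (normalise p))) div) 0≤x bx bρ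

  ⟦_⟧-cong : ∀ {n} (p : Polynomial n) {ρ ρ′ : Env n} → Pointwise _≈_ ρ ρ′ → ⟦ p ⟧ ρ ≈ ⟦ p ⟧ ρ′
  ⟦ op [+] p₁ p₂ ⟧-cong ρ≈ρ′ = +-cong (⟦ p₁ ⟧-cong ρ≈ρ′) (⟦ p₂ ⟧-cong ρ≈ρ′)
  ⟦ op [*] p₁ p₂ ⟧-cong ρ≈ρ′ = *-cong (⟦ p₁ ⟧-cong ρ≈ρ′) (⟦ p₂ ⟧-cong ρ≈ρ′)
  ⟦ con c        ⟧-cong ρ≈ρ′ = refl
  ⟦ var i        ⟧-cong ρ≈ρ′ = Pointwise.lookup ρ≈ρ′ i
  ⟦ p :^ k       ⟧-cong ρ≈ρ′ = ^-congˡ k (⟦ p ⟧-cong ρ≈ρ′)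
  ⟦ :- p         ⟧-cong ρ≈ρ′ = -‿cong (⟦ p ⟧-cong ρ≈ρ′)

  -- For s = q (1 - q) and y = 1 / ((1 - 2q)² n), the factor of (1 - q) / (1 - 2q)²
  -- in the expansion of dₙ / pₙ is `series`.  By 2 q D dₙ = n (πₙ - D pₙ), this
  -- makes D * `ratio` the expansion of πₙ / pₙ; `ratio⁻¹` inverts `ratio` up to y⁶.
  module _ {n} (s : Polynomial n) where
    series : Polynomial n → Polynomial n
    series y = int 1 :- y :* (int 1 :- y :* (int 6 :* s :+ int 1 :-
      y :* (int 36 :* s :^ 2 :+ int 24 :* s :+ int 1 :-
      y :* (int 216 :* s :^ 3 :+ int 372 :* s :^ 2 :+ int 66 :* s :+ int 1))))

    ratio : Polynomial n → Polynomial n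
    ratio y = int 1 :+ int 2 :* s :* y :* series y

    ratio⁻¹ : Polynomial n → Polynomial n
    ratio⁻¹ y = int 1 :- int 2 :* s :* y :* (int 1 :- y :* (int 2 :* s :+ int 1 :-
      y :* (int 4 :* s :^ 2 :+ int 10 :* s :+ int 1 :-
      y :* (int 8 :* s :^ 3 :+ int 72 :* s :^ 2 :+ int 30 :* s :+ int 1 :-
      y :* (int 16 :* s :^ 4 :+ int 464 :* s :^ 3 :+ int 516 :* s :^ 2 :+ int 74 :* s :+ int 1)))))

-- The asymptotic expansion, with index m standing for n = m + 1.

module Asymptotics {c ℓ₁ ℓ₂} (ℝ : RealNumbers c ℓ₁ ℓ₂) (β : Bias (RealNumbers.orderedField ℝ)) where
  open RealNumbers ℝ hiding (zero)
  open OrderedFieldProperties orderedField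
  open IntegerSolver commutativeRing
  open PolynomialBounds ℝ
  open GameValue ℝ β public
  open Exp commutativeSemiring using (^-distrib-*; ^-congˡ)

  x : ℕ → Carrier
  x m = 1/ (suc m)

  n*x≈1 : ∀ m → suc m · 1# * x m ≈ 1#
  n*x≈1 m = y*[x/y]≈x 1# (0<n·1 (suc m))

  0<x : ∀ m → 0# < x m
  0<x m = 0<1/ (0<n·1 (suc m))

  x-x′≈x*x′ : ∀ m → x m - x (suc m) ≈ x m * x (suc m)
  x-x′≈x*x′ m = linear-combination (+-cong (*-congˡ (sym (n*x≈1 (suc m)))) (*-congˡ (n*x≈1 m)))
    (solve 3 (λ n x x′ → x :- x′ :+ (x :* ((int 1 :+ (int 1 :+ n)) :* x′) :+ x′ :* int 1) :=
      x :* x′ :+ (x :* int 1 :+ x′ :* ((int 1 :+ n) :* x))) (m · 1#) (x m) (x (suc m)))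

  x≤1 : ∀ m → x m ≤ 1#
  x≤1 m = 0≤d⇒x≤x+d (*-nonneg (0≤n·1 m) (<⇒≤ (0<x m)))
    (trans (sym (n*x≈1 m)) (solve 2 (λ n x → (int 1 :+ n) :* x := x :+ n :* x) (m · 1#) (x m)))

  -- Each power of 1 / n in the expansion carries a factor (1 - 2q)⁻². Taken together, they leave
  -- coefficients that are integer polynomials in `s`.
  y : ℕ → Carrier
  y m = δ ^ 2 * x m

  0<y : ∀ m → 0# < y m
  0<y m = *-pos (^-pos 2 0<δ) (0<x m)

  0≤y : ∀ m → 0# ≤ y m
  0≤y m = <⇒≤ (0<y m)

  y≤δ² : ∀ m → y m ≤ δ ^ 2
  y≤δ² m = ≤-respʳ (*-identityʳ _) (*-monoˡ-≤ (^-nonneg 2 (<⇒≤ 0<δ)) (x≤1 m))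

  y-antitone : ∀ k m → y (k ℕ.+ m) ≤ y m
  y-antitone zero    m = ≤-refl
  y-antitone (suc k) m = ≤-trans (*-monoˡ-≤ (^-nonneg 2 (<⇒≤ 0<δ))
    (0≤d⇒x≤x+d (<⇒≤ (*-pos (0<x (k ℕ.+ m)) (0<x (suc (k ℕ.+ m)))))
      (trans (solve 2 (λ x x′ → x := x′ :+ (x :- x′)) (x (k ℕ.+ m)) (x (suc (k ℕ.+ m))))
        (+-congˡ (x-x′≈x*x′ (k ℕ.+ m)))))) (y-antitone k m)

  s : Carrier
  s = q * a

  -- This is D² in terms of `s`. The numeral 4 is spelled as the solver evaluates it, so that
  -- polynomials in `s` evaluate to this very term.
  e : Carrier
  e = 1# - (((1# + 1#) + 1#) + 1#) * s

  e*δ²≈1 : e * δ ^ 2 ≈ 1#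
  e*δ²≈1 = linear-combination (*-congˡ D*δ≈1)
    (solve 2 (λ q δ → let D = int 1 :- 2 :× q in
      (int 1 :- int 4 :* (q :* (int 1 :- q))) :* δ :^ 2 :+ (int 1 :+ D :* δ) :* int 1 :=
      int 1 :+ (int 1 :+ D :* δ) :* (D :* δ)) q δ)

  e*y≈x : ∀ m → e * y m ≈ x m
  e*y≈x m = trans (sym (*-assoc _ _ _)) (trans (*-congʳ e*δ²≈1) (*-identityˡ _))

  r : ℕ → Carrier
  r m = 1# + e * y m

  y≈y′*r : ∀ m → y m ≈ y (suc m) * r m
  y≈y′*r m = linear-combination
    (+-cong (*-congˡ (x-x′≈x*x′ m)) (*-congˡ (sym (e*y≈x m))))
    (solve 4 (λ e d x x′ →
      d :* x :+ (d :* (x :* x′) :+ d :* x′ :* (e :* (d :* x))) :=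
      d :* x′ :* (int 1 :+ e :* (d :* x)) :+ (d :* (x :- x′) :+ d :* x′ :* x))
      e (δ ^ 2) (x m) (x (suc m)))

  bounded-y : Bounded y
  bounded-y = δ ^ 2 , λ m → nonneg⇒∣∣≤ (0≤y m) (y≤δ² m)

  bounded-const : ∀ z → Bounded (λ _ → z)
  bounded-const z = proj₁ (constant-bound z) , λ _ → proj₂ (constant-bound z)

  bounded-r : Bounded r
  bounded-r = 1# + e * δ ^ 2 , λ m → nonneg⇒∣∣≤
    (≤-respʳ (+-congˡ (sym (e*y≈x m))) (0≤+ 0≤1 (<⇒≤ (0<x m))))
    (≤-trans (≤-reflexive (+-congˡ (e*y≈x m)))
      (≤-respʳ (+-congˡ (sym e*δ²≈1)) (+-mono-≤ ≤-refl (x≤1 m))))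

  S V U : Carrier → Carrier
  S z = ⟦ series (var 1F) (var 0F) ⟧ (z ∷ s ∷ [])
  V z = ⟦ ratio (var 1F) (var 0F) ⟧ (z ∷ s ∷ [])
  U z = ⟦ ratio⁻¹ (var 1F) (var 0F) ⟧ (z ∷ s ∷ [])

  U-cong : ∀ {z z′} → z ≈ z′ → U z ≈ U z′
  U-cong z≈z′ = ⟦ ratio⁻¹ (var 1F) (var 0F) ⟧-cong (z≈z′ ∷ refl ∷ [])

  env : BoundedEnv (λ _ → s ∷ [])
  env = bounded-const s ∷ []

  -- Abstract, so that the normal forms behind the bounds are never evaluated.
  abstract
    S-1-order : (λ m → S (y m) - 1#) =O[ y ^ 1 ]
    S-1-order = polynomial-order 1 (series (var 1F) (var 0F) :- int 1) 0≤y bounded-y env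

    U-bounded : (λ m → U (y m)) =O[ y ^ 0 ]
    U-bounded = polynomial-order 0 (ratio⁻¹ (var 1F) (var 0F)) 0≤y bounded-y env

    V-bounded : (λ m → V (y m)) =O[ y ^ 0 ]
    V-bounded = polynomial-order 0 (ratio (var 1F) (var 0F)) 0≤y bounded-y env

    1-UV-order : (λ m → 1# - U (y m) * V (y m)) =O[ y ^ 6 ]
    1-UV-order = polynomial-order 6
      (int 1 :- ratio⁻¹ (var 1F) (var 0F) :* ratio (var 1F) (var 0F)) 0≤y bounded-y env

  -- In terms of y′ = y (suc m), y = y′ / (1 - e y′) is expanded up to y′⁶, the
  -- remainder being expressed by r = 1 / (1 - e y′).
  expand : ∀ {n} (y′ r e : Polynomial n) → Polynomial n
  expand y′ r e = y′ :* (int 1 :+ t :* (int 1 :+ t :* (int 1 :+ t :* (int 1 :+ t :* (int 1 :+ t :* r)))))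
    where t = e :* y′

  -- δ * defect m is the error of δ U in the recurrence
  -- P m / Π m = D + (4 s - 2 s x (suc m)) P (suc m) / Π (suc m), where e y = x.
  defect : ℕ → Carrier
  defect m = e - U (y m) + (int₄ * s - int₂ * s * e * y (suc m)) * U (y (suc m))
    where
    int₂ = 1# + 1#
    int₄ = 1# + 1# + 1# + 1#

  defect-poly : Polynomial 3
  defect-poly = e′ :- ratio⁻¹ s′ (expand y′ (var 1F) e′) :+
      (int 4 :* s′ :- int 2 :* s′ :* e′ :* y′) :* ratio⁻¹ s′ y′
    where
    y′ = var 0F
    s′ = var 2F
    e′ = int 1 :- int 4 :* s′

  -- `r m` is a fixed point of `z ↦ 1 + e y′ z`, and `expand` applies this map five times to it.
  expand-correct : ∀ m → ⟦ expand (var 0F) (var 1F) (int 1 :- int 4 :* var 2F) ⟧ (y (suc m) ∷ r m ∷ s ∷ []) ≈ y m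
  expand-correct m = trans (*-congˡ (unfold (unfold (unfold (unfold (unfold refl)))))) (sym (y≈y′*r m))
    where
    unfold : ∀ {z} → z ≈ r m → 1# + e * y (suc m) * z ≈ r m
    unfold z≈r = +-congˡ (trans (*-assoc _ _ _) (*-congˡ (trans (*-congˡ z≈r) (sym (y≈y′*r m)))))

  abstract
    -- Here the coefficients of `ratio⁻¹` are verified against the recurrence. The computation gives
    -- a bound in `y (suc m)`, which is at most `y m`.
    defect-order : defect =O[ y ^ 6 ]
    defect-order = proj₁ bound , λ m → ∣∣≤-trans
      (∣∣≤-resp (+-congʳ (+-congˡ (-‿cong (U-cong (expand-correct m))))) (proj₂ bound m))
      (*-monoˡ-≤ (0≤b m) (^-mono-≤ 6 (0≤y (suc m)) (y-antitone 1 m)))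
      where
      bound : (λ m → ⟦ defect-poly ⟧ (y (suc m) ∷ r m ∷ s ∷ [])) =O[ (λ m → y (suc m)) ^ 6 ]
      bound = polynomial-order 6 defect-poly (λ m → 0≤y (suc m))
        (proj₁ bounded-y , λ m → proj₂ bounded-y (suc m)) (bounded-r ∷ env)
      0≤b : ∀ (m : ℕ) → 0# ≤ proj₁ bound
      0≤b m = *-cancelˡ-≤ (^-pos 6 (0<y (suc m))) (≤-respˡ (sym (zeroʳ _))
        (≤-respʳ (*-comm _ _) (∣∣≤⇒0≤ (proj₂ bound m))))

  P Π : ℕ → Carrier
  P m = win (suc m) (suc m)
  Π m = binomial (suc m) (suc m)

  0<Π : ∀ m → 0# < Π m
  0<Π m = 0<binomial (suc m) (suc m)

  Π-suc : ∀ m → Π (suc m) ≈ ((1# + 1# + 1# + 1#) * s - (1# + 1#) * s * e * y (suc m)) * Π m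
  Π-suc m = linear-combination
    (+-cong (*-congˡ (sym (n*x≈1 (suc m)))) (+-cong (*-congˡ (binomial-diagonal-suc (suc m)))
      (+-cong (*-congˡ (n*x≈1 (suc m))) (*-congˡ (e*y≈x (suc m))))))
    (solve 8 (λ q n x y e p p′ a → let s = q :* a ; N = int 1 :+ n in
      p′ :+ (p′ :* (N :* x) :+ (x :* ((n :+ N) :* (q :* a :+ q :* a) :* p)
        :+ (int 4 :* s :* p :* int 1 :+ int 2 :* s :* p :* x))) :=
      (int 4 :* s :- int 2 :* s :* e :* y) :* p :+ (p′ :* int 1 :+ (x :* (N :* p′)
        :+ (int 4 :* s :* p :* (N :* x) :+ int 2 :* s :* p :* (e :* y)))))
      q (suc m · 1#) (x (suc m)) (y (suc m)) e (Π m) (Π (suc m)) a)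

  P-suc : ∀ m → P m - P (suc m) ≈ D * Π m
  P-suc m = linear-combination (sym (win-diagonal-suc m))
    (solve 4 (λ D p p′ b → p :- p′ :+ p′ := D :* b :+ (p :- D :* b)) D (P m) (P (suc m)) (Π m))

  DΠ≤P : ∀ m → D * Π m ≤ P m
  DΠ≤P m = 0≤d⇒x≤x+d (<⇒≤ (0<win (suc m))) (trans
    (solve 2 (λ p p′ → p := p :- p′ :+ p′) (P m) (P (suc m))) (+-congʳ (P-suc m)))

  -- By `duration-win` the difference is a positive multiple of an expected duration. Together with
  -- `P-suc` it forces geometric decay of `P`.
  DP≤Π : ∀ m → D * P m ≤ Π m
  DP≤Π m = 0≤d⇒x≤x+d {d = Π m - D * P m}
    (*-cancelˡ-≤ (0<n·1 (suc m)) (≤-respˡ (sym (zeroʳ _)) (≤-respʳ (duration-win m)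
      (*-nonneg (0≤+ 0≤q 0≤q) (≤-respʳ (sym (duration-diagonal (suc m))) (0≤shortfall (suc m) (suc m)))))))
    (solve 2 (λ x y → x := y :+ (x :- y)) (Π m) (D * P m))

  Π≤δP : ∀ m → Π m ≤ δ * P m
  Π≤δP m = *-cancelˡ-≤ 0<D (≤-respʳ
    (trans (sym (*-identityˡ _)) (trans (*-congʳ (sym D*δ≈1)) (*-assoc _ _ _))) (DΠ≤P m))

  P-antitone : ∀ k m → P (k ℕ.+ m) ≤ P m
  P-antitone zero    m = ≤-refl
  P-antitone (suc k) m = ≤-trans (0≤d⇒x≤x+d (<⇒≤ (*-pos 0<D (0<Π (k ℕ.+ m))))
    (trans (solve 2 (λ p p′ → p := p′ :+ (p :- p′)) (P (k ℕ.+ m)) (P (suc (k ℕ.+ m))))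
      (+-congˡ (P-suc (k ℕ.+ m))))) (P-antitone k m)

  0<D² : 0# < D * D
  0<D² = *-pos 0<D 0<D

  0≤1-D² : 0# ≤ 1# - D * D
  0≤1-D² = ≤-respʳ (solve 1 (λ q → (4 :× int 1) :* (q :* (int 1 :- q)) :=
      int 1 :- (int 1 :- 2 :× q) :* (int 1 :- 2 :× q)) q)
    (*-nonneg (0≤n·1 4) (*-nonneg 0≤q 0≤a))

  P-geometric : ∀ k m → P (k ℕ.+ m) ≤ (1# - D * D) ^ k * P m
  P-geometric zero    m = ≤-reflexive (sym (*-identityˡ _))
  P-geometric (suc k) m = begin
    P (suc (k ℕ.+ m))
      ≤⟨ 0≤d⇒x≤x+d (*-nonneg (<⇒≤ 0<D) (x≤y⇒0≤y-x (DP≤Π (k ℕ.+ m))))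
           (linear-combination (P-suc (k ℕ.+ m)) (solve 4 (λ D p p′ b →
             (int 1 :- D :* D) :* p :+ D :* b := p′ :+ D :* (b :- D :* p) :+ (p :- p′))
             D (P (k ℕ.+ m)) (P (suc (k ℕ.+ m))) (Π (k ℕ.+ m)))) ⟩
    (1# - D * D) * P (k ℕ.+ m)
      ≤⟨ *-monoˡ-≤ 0≤1-D² (P-geometric k m) ⟩
    (1# - D * D) * ((1# - D * D) ^ k * P m)
      ≈⟨ *-assoc _ _ _ ⟨
    (1# - D * D) ^ suc k * P m ∎
    where open ≤-Reasoning

  -- The error of approximating P / Π by δ U, times Π.
  h : ℕ → Carrier
  h m = P m - Π m * (δ * U (y m))

  -- `P-suc` allows `Π m` to be replaced by `δ * (P m - P (suc m))`, and `δ * δ * e` is 1. The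
  -- increments of `h` thus carry the decrements of `P` as weights.
  h-step : ∀ m → h m - h (suc m) ≈ δ * δ * (P m - P (suc m)) * defect m
  h-step m = eliminate (P m) (P (suc m)) (Π m) (Π (suc m)) (U (y m)) (U (y (suc m))) δ
      ((1# + 1# + 1# + 1#) * s - (1# + 1#) * s * e * y (suc m))
      (P-suc m) (Π-suc m) D*δ≈1
    where
    eliminate : ∀ p p′ b b′ u u′ δ l → p - p′ ≈ D * b → b′ ≈ l * b → D * δ ≈ 1# →
      p - b * (δ * u) - (p′ - b′ * (δ * u′)) ≈ δ * δ * (p - p′) * (e - u + l * u′)
    eliminate p p′ b b′ u u′ δ l p≈ b≈ δ≈ = linear-combination
      (+-cong (*-congˡ p≈) (+-cong (*-congˡ b≈) (*-congˡ (sym δ≈))))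
      (solve 9 (λ p p′ b b′ u u′ δ l q →
        let D = int 1 :- 2 :× q
            M = int 1 :- int 4 :* (q :* (int 1 :- q)) :- u :+ l :* u′
            k₁ = int 1 :- δ :* δ :* M
            k₂ = δ :* M :* b :+ D :* b in
        p :- b :* (δ :* u) :- (p′ :- b′ :* (δ :* u′))
          :+ (k₁ :* (D :* b) :+ (δ :* u′ :* (l :* b) :+ k₂ :* (D :* δ))) :=
        δ :* δ :* (p :- p′) :* M
          :+ (k₁ :* (p :- p′) :+ (δ :* u′ :* b′ :+ k₂ :* int 1)))
        p p′ b b′ u u′ δ l q)

  0≤constant : ∀ k {b z} → ∣ z ∣≤ b * y 0 ^ k → 0# ≤ b
  0≤constant k ∣z∣≤ = *-cancelˡ-≤ (^-pos k (0<y 0))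
    (≤-respˡ (sym (zeroʳ _)) (≤-respʳ (*-comm _ _) (∣∣≤⇒0≤ ∣z∣≤)))

  h-telescopes : ∃[ C ] ∀ k m → ∣ h m - h (k ℕ.+ m) ∣≤ C * y m ^ 6 * (P m - P (k ℕ.+ m))
  h-telescopes = C , telescope
    where
    C₀ = proj₁ defect-order
    C = δ * δ * C₀
    0≤C₀ : 0# ≤ C₀
    0≤C₀ = 0≤constant 6 (proj₂ defect-order 0)
    0≤δ² : 0# ≤ δ * δ
    0≤δ² = *-nonneg (<⇒≤ 0<δ) (<⇒≤ 0<δ)
    0≤ΔP : ∀ m → 0# ≤ P m - P (suc m)
    0≤ΔP m = x≤y⇒0≤y-x (P-antitone 1 m)

    step-bound : ∀ m → ∣ h m - h (suc m) ∣≤ C * y m ^ 6 * (P m - P (suc m))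
    step-bound m = ∣∣≤-trans
      (∣∣≤-resp (sym (h-step m)) (*-∣∣≤ (*-nonneg 0≤δ² (0≤ΔP m)) (proj₂ defect-order m)))
      (≤-reflexive (solve 4 (λ d p c y → d :* p :* (c :* y) := d :* c :* y :* p)
        (δ * δ) (P m - P (suc m)) C₀ (y m ^ 6)))

    telescope : ∀ k m → ∣ h m - h (k ℕ.+ m) ∣≤ C * y m ^ 6 * (P m - P (k ℕ.+ m))
    telescope zero    m = nonneg⇒∣∣≤ (≤-reflexive (sym (-‿inverseʳ _)))
      (≤-reflexive (solve 3 (λ h c p → h :- h := c :* (p :- p)) (h m) (C * y m ^ 6) (P m)))
    telescope (suc k) m = ∣∣≤-resp
      (solve 3 (λ x y z → x :- y :+ (y :- z) := x :- z) (h m) (h (k ℕ.+ m)) (h (suc (k ℕ.+ m))))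
      (∣∣≤-trans (∣+∣≤ (telescope k m) (∣∣≤-trans (step-bound (k ℕ.+ m))
          (*-monoʳ-≤ (0≤ΔP (k ℕ.+ m)) (*-monoˡ-≤ (*-nonneg 0≤δ² 0≤C₀)
            (^-mono-≤ 6 (0≤y (k ℕ.+ m)) (y-antitone k m))))))
        (≤-reflexive (solve 4 (λ c x y z → c :* (x :- y) :+ c :* (y :- z) := c :* (x :- z))
          (C * y m ^ 6) (P m) (P (k ℕ.+ m)) (P (suc (k ℕ.+ m))))))

  -- A crude bound, needed only to make the far end of the telescoping sum vanish along with `P`.
  ∣h∣≤P : ∃[ b ] (0# ≤ b) × (∀ m → ∣ h m ∣≤ b * P m)
  ∣h∣≤P = 1# + δ * (δ * b) , 0≤+ 0≤1 (*-nonneg 0≤δ 0≤δb) , λ m → ∣∣≤-trans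
    (∣+∣≤ (nonneg⇒∣∣≤ (<⇒≤ (0<win m)) ≤-refl)
      (∣neg∣≤ (∣∣≤-trans (*-∣∣≤ (<⇒≤ (0<Π m)) (*-∣∣≤ 0≤δ (∣∣≤-trans (proj₂ U-bounded m)
        (≤-reflexive (*-identityʳ b))))) (*-monoʳ-≤ 0≤δb (Π≤δP m)))))
    (≤-reflexive (solve 3 (λ p δ b → p :+ δ :* p :* (δ :* b) := (int 1 :+ δ :* (δ :* b)) :* p) (P m) δ b))
    where
    b = proj₁ U-bounded
    0≤δ = <⇒≤ 0<δ
    0≤δb = *-nonneg 0≤δ (0≤constant 0 (proj₂ U-bounded 0))

  ≤-limit : ∀ {z b} (t : ℕ → Carrier) → (∀ ε → 0# < ε → ∃[ k ] t k < ε) → (∀ k → z ≤ b + t k) → z ≤ b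
  ≤-limit {z} {b} t t→0 z≤b+t b<z with t→0 (z - b) (x<y⇒0<y-x b<z)
  ... | k , t<z-b = z≤b+t k (<-respʳ (solve 2 (λ b z → b :+ (z :- b) := z) b z) (+-monoʳ-< b t<z-b))

  h-order : ∃[ b ] (0# ≤ b) × (∀ m → ∣ h m ∣≤ b * y m ^ 6 * P m)
  h-order = C , 0≤C , λ m →
    (≤-respʳ (solve 1 (λ h → :- (:- h) := h) (h m)) (neg-mono-≤ (bound m (- h m) (λ k → proj₂ (∣neg∣≤ (∣h∣≤ k m)))))) ,
    bound m (h m) (λ k → proj₂ (∣h∣≤ k m))
    where
    C = proj₁ h-telescopes
    b = proj₁ ∣h∣≤P
    0≤C : 0# ≤ C
    0≤C = *-nonneg (*-nonneg (<⇒≤ 0<δ) (<⇒≤ 0<δ)) (0≤constant 6 (proj₂ defect-order 0))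
    tail : ℕ → ℕ → Carrier
    tail m k = (1# - D * D) ^ k * (b * P m)
    0≤Cy⁶ : ∀ m → 0# ≤ C * y m ^ 6
    0≤Cy⁶ m = *-nonneg 0≤C (^-nonneg 6 (0≤y m))
    ∣h∣≤ : ∀ k m → ∣ h m ∣≤ C * y m ^ 6 * P m + tail m k
    ∣h∣≤ k m = ∣∣≤-resp (solve 2 (λ x y → x :- y :+ y := x) (h m) (h (k ℕ.+ m)))
      (∣+∣≤
        (∣∣≤-trans (proj₂ h-telescopes k m) (*-monoˡ-≤ (0≤Cy⁶ m)
          (0≤d⇒x≤x+d (<⇒≤ (0<win (k ℕ.+ m))) (solve 2 (λ x y → x := x :- y :+ y) (P m) (P (k ℕ.+ m))))))
        (∣∣≤-trans (proj₂ (proj₂ ∣h∣≤P) (k ℕ.+ m)) (≤-trans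
          (*-monoˡ-≤ (proj₁ (proj₂ ∣h∣≤P)) (P-geometric k m))
          (≤-reflexive (solve 3 (λ x y z → x :* (y :* z) := y :* (x :* z)) b ((1# - D * D) ^ k) (P m))))))
    bound : ∀ m z → (∀ k → z ≤ C * y m ^ 6 * P m + tail m k) → z ≤ C * y m ^ 6 * P m
    bound m z = ≤-limit (tail m) λ ε 0<ε →
      let null = geometric-null 0<D² 0≤1-D² (*-nonneg (proj₁ (proj₂ ∣h∣≤P)) (<⇒≤ (0<win m))) ε 0<ε
      in proj₁ null , proj₂ null (proj₁ null) ℕ.≤-refl

  ratio-error : ℕ → Carrier
  ratio-error m = Π m - P m * (D * V (y m))

  -- As `D * δ` is 1, the error splits into `Π (1 - U V)` and `h` times `D V`. This inverts the
  -- approximate quotient without any division by it.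
  ratio-error-order : ∃[ b ] ∀ m → ∣ ratio-error m ∣≤ b * y m ^ 6 * P m
  ratio-error-order = δ * b₁ + b₂ * (D * b₃) , λ m → ∣∣≤-trans
    (∣∣≤-resp (sym (split m (U (y m)) (V (y m))))
      (∣+∣≤
        (∣∣≤-trans (*-∣∣≤ (<⇒≤ (0<Π m)) (proj₂ 1-UV-order m))
          (*-monoʳ-≤ (*-nonneg (0≤constant 6 (proj₂ 1-UV-order 0)) (^-nonneg 6 (0≤y m))) (Π≤δP m)))
        (∣neg∣≤ (∣*∣≤ (proj₂ (proj₂ h-order) m) (*-∣∣≤ (<⇒≤ 0<D) (proj₂ V-bounded m))))))
    (≤-reflexive (solve 7 (λ δ D b₁ b₂ b₃ y p →
      δ :* p :* (b₁ :* y) :+ b₂ :* y :* p :* (D :* (b₃ :* int 1)) :=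
      (δ :* b₁ :+ b₂ :* (D :* b₃)) :* y :* p) δ D b₁ b₂ b₃ (y m ^ 6) (P m)))
    where
    b₁ = proj₁ 1-UV-order
    b₂ = proj₁ h-order
    b₃ = proj₁ V-bounded
    split : ∀ m u v → Π m - P m * (D * v) ≈ Π m * (1# - u * v) - (P m - Π m * (δ * u)) * (D * v)
    split m u v = linear-combination (*-congˡ (sym D*δ≈1))
      (solve 6 (λ p b D δ u v → b :- p :* (D :* v) :+ b :* u :* v :* (D :* δ) :=
        b :* (int 1 :- u :* v) :- (p :- b :* (δ :* u)) :* (D :* v) :+ b :* u :* v :* int 1)
        (P m) (Π m) D δ u v)

  expansion : ℕ → Carrier
  expansion m = a * δ ^ 2 * S (y m)

  -- Both terms are cleared of denominators: `duration-win` rewrites the duration, and n y = δ²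
  -- turns the multiple of `S` into the nonconstant part of `V`.
  error-identity : ∀ m → (q + q) * D * P m * (conditionalDuration m - expansion m) ≈
    suc m · 1# * ratio-error m
  error-identity m = eliminate (duration (suc m) (suc m)) (P m) (conditionalDuration m) (Π m)
    (suc m · 1#) (x m) (δ ^ 2) (S (y m)) (y*[x/y]≈x _ (0<win m)) (duration-win m) (n*x≈1 m)
    where
    eliminate : ∀ d p E b n x δ² S → p * E ≈ d → (q + q) * (D * d) ≈ n * (b - D * p) → n * x ≈ 1# →
      (q + q) * D * p * (E - a * δ² * S) ≈ n * (b - p * (D * (1# + (1# + 1#) * s * (δ² * x) * S)))
    eliminate d p E b n x δ² S E≈ d≈ x≈ = linear-combination
      (+-cong (*-congˡ E≈) (+-cong d≈ (*-congˡ x≈)))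
      (solve 10 (λ q D d p E b n x δ² S → let a = int 1 :- q in
        (q :+ q) :* D :* p :* (E :- a :* δ² :* S)
          :+ ((q :+ q) :* D :* d :+ (n :* (b :- D :* p) :+ int 2 :* q :* a :* D :* p :* δ² :* S :* int 1)) :=
        n :* (b :- p :* (D :* (int 1 :+ int 2 :* (q :* a) :* (δ² :* x) :* S)))
          :+ ((q :+ q) :* D :* (p :* E) :+ ((q :+ q) :* (D :* d)
          :+ int 2 :* q :* a :* D :* p :* δ² :* S :* (n :* x))))
        q D d p E b n x δ² S)

  expansion-order : (λ m → conditionalDuration m - expansion m) =O[ y ^ 5 ]
  -- The factor n of `error-identity` turns y⁶ into δ² y⁵, and `v` removes the factor 2 q D.
  expansion-order = v * b * δ ^ 2 , λ m → *-cancel-∣∣≤ (*-pos 0<2qD (0<win m))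
    (∣∣≤-trans (∣∣≤-resp (sym (error-identity m))
        (*-∣∣≤ (0≤n·1 (suc m)) (proj₂ ratio-error-order m)))
      (≤-reflexive (linear-combination
        (+-cong (*-congˡ (n*x≈1 m)) (*-congˡ (sym (y*[x/y]≈x 1# 0<2qD))))
        (solve 8 (λ n x d v b w p y⁵ → let k = b :* d :* p :* y⁵ in
          n :* (b :* (d :* x :* y⁵) :* p) :+ (k :* int 1 :+ k :* (w :* v)) :=
          w :* p :* (v :* b :* d :* y⁵) :+ (k :* (n :* x) :+ k :* int 1))
          (suc m · 1#) (x m) (δ ^ 2) v b ((q + q) * D) (P m) (y m ^ 5)))))
    where
    0<2qD : 0# < (q + q) * D
    0<2qD = *-pos (0<+ 0<q 0≤q) 0<D
    v = 1# / (q + q) * D [ 0<2qD ]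
    b = proj₁ ratio-error-order

  limit-order : ∃[ b ] ∀ m → ∣ conditionalDuration m - a * δ ^ 2 ∣≤ b * x m
  limit-order = (b₁ * (δ ^ 2) ^ 4 + a * δ ^ 2 * b₂) * δ ^ 2 , λ m → ∣∣≤-trans
    (∣∣≤-resp
      (solve 3 (λ E k S → E :- k :* S :+ k :* (S :- int 1) := E :- k)
        (conditionalDuration m) (a * δ ^ 2) (S (y m)))
      (∣+∣≤
        (∣∣≤-trans (proj₂ expansion-order m) (*-monoˡ-≤ (0≤constant 5 (proj₂ expansion-order 0))
          (*-monoˡ-≤ (0≤y m) (^-mono-≤ 4 (0≤y m) (y≤δ² m)))))
        (*-∣∣≤ (*-nonneg 0≤a (^-nonneg 2 (<⇒≤ 0<δ))) (proj₂ S-1-order m))))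
    (≤-reflexive (solve 6 (λ b₁ b₂ d D k x →
      b₁ :* (d :* x :* D) :+ k :* (b₂ :* (d :* x :* int 1)) := (b₁ :* D :+ k :* b₂) :* d :* x)
      b₁ b₂ (δ ^ 2) ((δ ^ 2) ^ 4) (a * δ ^ 2) (x m)))
    where
    b₁ = proj₁ expansion-order
    b₂ = proj₁ S-1-order

  =O[1/n]⇒⟶ : ∀ (f : Sequence) {l b} → (∀ m → ∣ f (suc m) - l ∣≤ b * x m) → f ⟶ l
  =O[1/n]⇒⟶ f {l} {b} ∣f-l∣≤ ε 0<ε with archimedean (b / ε [ 0<ε ])
  ... | N , b/ε<N = N , eventually
    where
    bx<ε : ∀ m → N ℕ.≤ suc m → b * x m < ε
    bx<ε m N≤n = begin-strict
      b * x m                             ≈⟨ trans (*-comm _ _) (*-congˡ (sym (y*[x/y]≈x b 0<ε))) ⟩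
      x m * (ε * (b / ε [ 0<ε ]))         <⟨ *-monoˡ-< (0<x m) (*-monoˡ-< 0<ε b/ε<N) ⟩
      x m * (ε * (N · 1#))                ≤⟨ *-monoˡ-≤ (<⇒≤ (0<x m)) (*-monoˡ-≤ (<⇒≤ 0<ε) (·-mono-≤ N≤n)) ⟩
      x m * (ε * (suc m · 1#))            ≈⟨ solve 3 (λ x ε n → x :* (ε :* n) := ε :* (n :* x)) (x m) ε (suc m · 1#) ⟩
      ε * (suc m · 1# * x m)              ≈⟨ trans (*-congˡ (n*x≈1 m)) (*-identityʳ ε) ⟩
      ε                                   ∎
      where open ≤-Reasoning
    close : ∀ m → N ℕ.≤ suc m → (f (suc m) < l + ε) × (l < f (suc m) + ε)
    close m N≤n =
      (<-respˡ (solve 2 (λ f l → l :+ (f :- l) := f) (f (suc m)) l)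
        (+-monoʳ-< l (≤-<-trans (proj₂ (∣f-l∣≤ m)) (bx<ε m N≤n)))) ,
      (<-respˡ (solve 2 (λ f l → f :+ :- (f :- l) := l) (f (suc m)) l)
        (+-monoʳ-< (f (suc m)) (≤-<-trans (proj₂ (∣neg∣≤ (∣f-l∣≤ m))) (bx<ε m N≤n))))
    eventually : ∀ n → .{{_ : NonZero n}} → N ℕ.≤ n → (f n < l + ε) × (l < f n + ε)
    eventually zero {{n≢0}} _ = contradiction ≡.refl (ℕ.≢-nonZero⁻¹ 0 {{n≢0}})
    eventually (suc m)        = close m

-- Return to the coefficients in q.

module Conclusion {c ℓ₁ ℓ₂} (ℝ : RealNumbers c ℓ₁ ℓ₂) (β : Bias (RealNumbers.orderedField ℝ)) where
  open RealNumbers ℝ hiding (zero)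
  open OrderedFieldProperties orderedField
  open IntegerSolver commutativeRing
  open PolynomialBounds ℝ
  open TwoPhaseGame ℝ
  open Asymptotics ℝ β public
  open Exp commutativeSemiring using (^-distrib-*; ^-congˡ)

  E : Sequence
  E zero    = 0#
  E (suc m) = conditionalDuration m

  E-correct : ∀ n → .{{_ : NonZero n}} → IsConditionalExpectation q n (E n)
  E-correct zero {{n≢0}} = contradiction ≡.refl (ℕ.≢-nonZero⁻¹ 0 {{n≢0}})
  E-correct (suc m)      = conditionalDuration-correct m

  explicitExpansion : Sequence
  explicitExpansion n =
    (1# - q) * δ ^ 2 *
      (1#
        - δ ^ 2 * 1/ n
        - (6 · q ^ 2 - 6 · q - 1#) * δ ^ 4 * (1/ n) ^ 2
        - (36 · q ^ 4 - 72 · q ^ 3 + 12 · q ^ 2 + 24 · q + 1#) * δ ^ 6 * (1/ n) ^ 3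
        - (216 · q ^ 6 - 648 · q ^ 5 + 276 · q ^ 4 + 528 · q ^ 3 - 306 · q ^ 2 - 66 · q - 1#) * δ ^ 8 * (1/ n) ^ 4)

  -- The coefficients in q are symmetric under exchanging q and 1 - q, hence polynomials in `s`: for
  -- example 6q² - 6q - 1 = - (6s + 1).
  expansion≈explicit : ∀ m → expansion m ≈ explicitExpansion (suc m)
  expansion≈explicit m = solve 3 (λ q δ x →
    (int 1 :- q) :* δ :^ 2 :* series (q :* (int 1 :- q)) (δ :^ 2 :* x) :=
    (int 1 :- q) :* δ :^ 2 :*
      (int 1
        :- δ :^ 2 :* x
        :- (6 :× (q :^ 2) :- 6 :× q :- int 1) :* δ :^ 4 :* x :^ 2
        :- (36 :× (q :^ 4) :- 72 :× (q :^ 3) :+ 12 :× (q :^ 2) :+ 24 :× q :+ int 1) :* δ :^ 6 :* x :^ 3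
        :- (216 :× (q :^ 6) :- 648 :× (q :^ 5) :+ 276 :× (q :^ 4) :+ 528 :× (q :^ 3) :- 306 :× (q :^ 2) :- 66 :× q :- int 1)
             :* δ :^ 8 :* x :^ 4)) q δ (x m)

  E-order : (λ n → E n - explicitExpansion n) =O (λ n → (1/ n) ^ 5)
  -- `expansion-order` is uniform in m, so the threshold is 0; the fifth power of δ² comes from y⁵.
  E-order = b * (δ ^ 2) ^ 5 , 0 , bound
    where
    b = proj₁ expansion-order
    bound : ∀ n → .{{_ : NonZero n}} → 0 ℕ.≤ n →
      (- (b * (δ ^ 2) ^ 5 * (1/ n) ^ 5) ≤ E n - explicitExpansion n) ×
      (E n - explicitExpansion n ≤ b * (δ ^ 2) ^ 5 * (1/ n) ^ 5)
    bound zero {{n≢0}} _ = contradiction ≡.refl (ℕ.≢-nonZero⁻¹ 0 {{n≢0}})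
    bound (suc m)      _ = ∣∣≤-trans
      (∣∣≤-resp (+-congˡ (-‿cong (expansion≈explicit m))) (proj₂ expansion-order m))
      (≤-reflexive (trans (*-congˡ (^-distrib-* (δ ^ 2) (x m) 5)) (sym (*-assoc _ _ _))))

  E-limit : E ⟶ (1# - q) * δ ^ 2
  E-limit = =O[1/n]⇒⟶ E (proj₂ limit-order)

theorem5 :
    ∀ {c ℓ₁ ℓ₂} (ℝ : RealNumbers c ℓ₁ ℓ₂) →
    let open RealNumbers ℝ
        open TwoPhaseGame ℝ
    in
    (q : Carrier) → 0# < q → (q<½ : q < 1/ 2) →
    let δ : Carrier
        δ = 1# / (1# - 2 · q) [ q<½⇒0<1-2q q<½ ]
    in
    Σ[ E ∈ Sequence ]
      (∀ n → .{{_ : NonZero n}} → IsConditionalExpectation q n (E n)) ×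
      (E ⟶ (1# - q) * δ ^ 2) ×
      ((λ n → E n -
          (1# - q) * δ ^ 2 *
            (1#
              - δ ^ 2 * 1/ n
              - (6 · q ^ 2 - 6 · q - 1#) * δ ^ 4 * (1/ n) ^ 2
              - (36 · q ^ 4 - 72 · q ^ 3 + 12 · q ^ 2 + 24 · q + 1#) * δ ^ 6 * (1/ n) ^ 3
              - (216 · q ^ 6 - 648 · q ^ 5 + 276 · q ^ 4 + 528 · q ^ 3 - 306 · q ^ 2 - 66 · q - 1#) * δ ^ 8 * (1/ n) ^ 4))
        =O (λ n → (1/ n) ^ 5))
theorem5 ℝ q 0<q q<½ = E , E-correct , E-limit , E-order
  where open Conclusion ℝ (bias q 0<q q<½)
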